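{- Let $H$ be a fixed non-matching graph with $e(H)\ge 3$. For every fixed integer $\ell\ge e(H)$, $$\lambda(H,\ell)\ge \max_{1\le j\le e(H)-1}\bigl(\pi_j(H)\log\ell+(1-\pi_j(H))\log j\bigr)$$ and $$\lambda(H,\ell)\le \pi_-(H)\log\ell+\bigl(1-\pi_-(H)\bigr)\log(e(H)-1).$$ Consequently, $$\lim_{\ell\to\infty}\frac{\lambda(H,\ell)}{\log\ell}=\pi_-(H).$$ Moreover, $\lambda(H,\ell)=\log(e(H)-1)$ for every integer $\ell\ge e(H)$ if and only if $H-e$ is bipartite for some $e\in E(H)$.
   Context: All graphs are finite and simple; $v(G)$, $e(G)$ denote numbers of vertices and edges. $H$ has no isolated vertices (isolated vertices play no role and are deleted). $H$ is non-matching if it contains two adjacent edges. Logarithms are natural. $[s]=\{1,\dots,s\}$. Copies of graphs are not required to be induced. For $S\subseteq E(H)$, $H-S$ is the spanning subgraph of $H$ obtained by deleting the edges in $S$, and $H-e=H-\{e\}$. For $1\le j\le e(H)-1$ let $\chi_j(H)=\min\{\chi(H-S):S\subseteq E(H),|S|=j\}$, where $\chi$ is the chromatic number, and let $$\pi_j(H)=\begin{cases}1-\dfrac{1}{\chi_j(H)-1},&\chi_j(H)\ge 3,\\ 0,&\chi_j(H)\le 2.\end{cases}$$ Write $\pi_-(H)=\pi_1(H)$. An $\ell$-palette template on $K_n$ is a map $\mathcal P:E(K_n)\to 2^{[\ell]}\setminus\{\emptyset\}$. A finite family of sets $A_1,\dots,A_q$ has a system of distinct representatives (SDR) if there are pairwise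 distinct $a_i\in A_i$. The template $\mathcal P$ is $H$-SDR-free if on every copy of $H$ in $K_n$ the palettes assigned to its edges have no SDR. Let $\operatorname{ex}_{\log}(n;H,\ell)$ be the maximum of $\sum_{e\in E(K_n)}\log|\mathcal P(e)|$ over all $H$-SDR-free $\ell$-palette templates $\mathcal P$ on $K_n$, and define $$\lambda(H,\ell)=\inf_{n\ge v(H)}\frac{\operatorname{ex}_{\log}(n;H,\ell)}{\binom n2}.$$ -}

module Defs where

open import Data.Fin.Base using (Fin; finToFun; funToFin)
import Data.Fin.Base as Fin
import Data.Fin.Properties as Fin
open import Data.Fin.Subset using (Subset; ∣_∣; _∈_; Nonempty)
open import Data.Fin.Subset.Properties using (_∈?_; anySubset?)
open import Data.Integer.Base using (+_)
open import Data.List.Base using (List; allFin; cartesianProduct; filter; foldr; length; lookup; map; upTo)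
open import Data.List.Extrema.Nat using (min)
open import Data.Nat.Base as ℕ using (ℕ; zero; suc; _!)
import Data.Nat.Properties as ℕ
open import Data.Nat.Combinatorics using (_C_)
open import Data.Product.Base using (∃-syntax; Σ-syntax; _×_; _,_; proj₁; proj₂)
open import Data.Product.Properties using (≡-dec)
open import Data.Rational.Base as ℚ using (ℚ; 0ℚ; 1ℚ)
import Data.Rational.Properties as ℚ
open import Algebra.Definitions.RawSemiring ℚ.+-*-rawSemiring using (_^_)
open import Data.Sum.Base using (_⊎_)
import Data.Sum.Base as Sum
open import Function.Base using (_∘_)
open import Function.Definitions using (Injective)
open import Relation.Binary.PropositionalEquality using (_≡_; _≢_; refl; sym; trans)
open import Relation.Nullary using (¬_; Dec)
import Relation.Nullary.Decidable as Dec
open import Relation.Nullary.Decidable using (_×-dec_; _⊎-dec_; _→-dec_; ¬?)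
open import Relation.Unary using (Decidable)

------------------------------------------------------------------------
-- Real numbers

-- A real x is given by its open upper Dedekind cut { q ∈ ℚ ∣ x < q }.
-- The empty cut is +∞ and the full cut is -∞.  Infima and suprema of
-- arbitrary families therefore exist.

record ℝ : Set₁ where
  field
    _<ℚ_    : ℚ → Set
    upward  : ∀ {p q} → _<ℚ_ p → p ℚ.< q → _<ℚ_ q
    rounded : ∀ {q} → _<ℚ_ q → ∃[ p ] p ℚ.< q × _<ℚ_ p

infix 4 _<ℚ_ _≤_ _≈_

_<ℚ_ : ℝ → ℚ → Set
_<ℚ_ = ℝ._<ℚ_

_≤_ : ℝ → ℝ → Set
x ≤ y = ∀ q → y <ℚ q → x <ℚ q

_≈_ : ℝ → ℝ → Set
x ≈ y = x ≤ y × y ≤ x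

-- The infimum of a set of rationals.

infℚ : (ℚ → Set) → ℝ
infℚ S = record
  { _<ℚ_    = λ q → ∃[ p ] S p × p ℚ.< q
  ; upward  = λ (p , Sp , p<q) q<r → p , Sp , ℚ.<-trans p<q q<r
  ; rounded = λ (p , Sp , p<q) → let (r , p<r , r<q) = ℚ.<-dense p<q in
                r , r<q , p , Sp , p<r
  }

fromℚ : ℚ → ℝ
fromℚ r = infℚ (_≡ r)

ℕ⇒ℚ : ℕ → ℚ
ℕ⇒ℚ n = + n ℚ./ 1

inf : {I : Set} → (I → ℝ) → ℝ
inf x = infℚ λ q → ∃[ i ] x i <ℚ q

-- The supremum is the infimum of the rational upper bounds.  For a finite
-- nonempty family it is the maximum.

sup : {I : Set} → (I → ℝ) → ℝ
sup x = infℚ λ q → ∀ i → x i ≤ fromℚ q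

infixl 6 _+_
infixr 7 _·_
infixl 7 _÷_

_+_ : ℝ → ℝ → ℝ
x + y = infℚ λ r → ∃[ p ] ∃[ q ] x <ℚ p × y <ℚ q × r ≡ p ℚ.+ q

-- Multiplication by a rational; only meaningful for r ≥ 0.

_·_ : ℚ → ℝ → ℝ
r · x = infℚ λ q → ∃[ p ] x <ℚ p × q ≡ r ℚ.* p

-- x ÷ y is the infimum of p / b over the rationals p > x and 0 < b ≤ y;
-- only meaningful for x ≥ 0 and y > 0.

_÷_ : ℝ → ℝ → ℝ
x ÷ y = infℚ λ r → ∃[ p ] ∃[ b ]
  x <ℚ p × 0ℚ ℚ.< b × fromℚ b ≤ y × p ℚ.≤ r ℚ.* b

Σℝ : List ℝ → ℝ
Σℝ = foldr _+_ (fromℚ 0ℚ)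

-- expSum k p = Σ_{i ≤ k} pⁱ / i!

expSum : ℕ → ℚ → ℚ
expSum zero    p = 1ℚ
expSum (suc k) p =
  expSum k p ℚ.+ p ^ suc k ℚ.* ℚ._/_ (+ 1) (suc k !) {{ℕ._!≢0 (suc k)}}

-- The natural logarithm of n ≥ 1 is inf { p ≥ 0 ∣ n ≤ exp p }.  On p ≥ 0
-- the partial sums of exp increase, so asking that one of them reaches n
-- changes the set by at most its least element.

log : ℕ → ℝ
log n = infℚ λ p → 0ℚ ℚ.≤ p × ∃[ k ] ℕ⇒ℚ n ℚ.≤ expSum k p

-- f ℓ → a as ℓ → ∞; |f ℓ - a| ≤ ε is written without subtraction.

Tendsto : (ℕ → ℝ) → ℝ → Set
Tendsto f a = ∀ ε → 0ℚ ℚ.< ε → ∃[ L ] ∀ ℓ → L ℕ.≤ ℓ →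
  a ≤ f ℓ + fromℚ ε × f ℓ ≤ a + fromℚ ε

------------------------------------------------------------------------
-- Finite simple graphs

record Graph : Set₁ where
  field
    order       : ℕ
    Adj         : Fin order → Fin order → Set
    adj?        : ∀ u v → Dec (Adj u v)
    symmetric   : ∀ {u v} → Adj u v → Adj v u
    irreflexive : ∀ {u} → ¬ Adj u u

open Graph public

-- Each edge {u , v} is listed once, as the pair (u , v) with u < v.

edges : (G : Graph) → List (Fin (order G) × Fin (order G))
edges G = filter (λ (u , v) → (u Fin.<? v) ×-dec adj? G u v)
                 (cartesianProduct (allFin (order G)) (allFin (order G)))

e : Graph → ℕ
e G = length (edges G)

-- The edge set is indexed by Fin (e G).

ends : (G : Graph) → Fin (e G) → Fin (order G) × Fin (order G)
ends G = lookup (edges G)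

Joins : (G : Graph) → Fin (e G) → Fin (order G) → Fin (order G) → Set
Joins G i u v = ends G i ≡ (u , v) ⊎ ends G i ≡ (v , u)

infixl 6 _-_

_-_ : (G : Graph) → Subset (e G) → Graph
G - S = record
  { order       = order G
  ; Adj         = λ u v → Adj G u v × ¬ Deleted u v
  ; adj?        = λ u v → adj? G u v ×-dec ¬? (deleted? u v)
  ; symmetric   = λ (a , ¬d) → symmetric G a , λ (i , i∈S , j) → ¬d (i , i∈S , Sum.swap j)
  ; irreflexive = λ (a , _) → irreflexive G a
  }
  where
  Deleted : Fin (order G) → Fin (order G) → Set
  Deleted u v = ∃[ i ] i ∈ S × Joins G i u v

  deleted? : ∀ u v → Dec (Deleted u v)
  deleted? u v = Fin.any? λ i → (i ∈? S) ×-dec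
    (≡-dec Fin._≟_ Fin._≟_ (ends G i) (u , v) ⊎-dec
     ≡-dec Fin._≟_ Fin._≟_ (ends G i) (v , u))

K : ℕ → Graph
K n = record
  { order       = n
  ; Adj         = _≢_
  ; adj?        = λ u v → ¬? (u Fin.≟ v)
  ; symmetric   = λ u≢v → u≢v ∘ sym
  ; irreflexive = λ u≢u → u≢u refl
  }

NoIsolated : Graph → Set
NoIsolated G = ∀ u → ∃[ v ] Adj G u v

NonMatching : Graph → Set
NonMatching G = ∃[ u ] ∃[ v ] ∃[ w ] v ≢ w × Adj G u v × Adj G u w

Proper : (G : Graph) {k : ℕ} → (Fin (order G) → Fin k) → Set
Proper G c = ∀ u v → Adj G u v → c u ≢ c v

Colorable : Graph → ℕ → Set
Colorable G k = Σ[ c ∈ (Fin (order G) → Fin k) ] Proper G c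

Bipartite : Graph → Set
Bipartite G = Colorable G 2

colorable? : ∀ G → Decidable (Colorable G)
colorable? G k = Dec.map′
  (λ (i , p) → finToFun i , p)
  (λ (c , p) → funToFin c , λ u v a eq → p u v a
    (trans (sym (Fin.finToFun-funToFin c u)) (trans eq (Fin.finToFun-funToFin c v))))
  (Fin.any? λ i → Fin.all? λ u → Fin.all? λ v →
    adj? G u v →-dec ¬? (finToFun {k} {order G} i u Fin.≟ finToFun i v))

-- The least m < b satisfying P, or b if there is none.

least : {P : ℕ → Set} → Decidable P → ℕ → ℕ
least P? b = min b (filter P? (upTo b))

-- Every graph is colourable with order-many colours, so the bounds
-- order G and order H below do not affect the minima.

χ : Graph → ℕ
χ G = least (colorable? G) (order G)

-- χⱼ j H = min { χ (H - S) ∣ S ⊆ E(H), |S| = j }, for j ≤ e H.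

χⱼ : ℕ → Graph → ℕ
χⱼ j H = least
  (λ m → anySubset? λ (S : Subset (e H)) → (∣ S ∣ ℕ.≟ j) ×-dec (χ (H - S) ℕ.≟ m))
  (order H)

-- turán m is 1 - 1/(m - 1) for m ≥ 3, and 0 for m ≤ 2.

turán : ℕ → ℚ
turán (suc (suc (suc k))) = 1ℚ ℚ.- + 1 ℚ./ suc (suc k)
turán _                   = 0ℚ

πⱼ : ℕ → Graph → ℚ
πⱼ j H = turán (χⱼ j H)

π₋ : Graph → ℚ
π₋ = πⱼ 1

------------------------------------------------------------------------
-- Palette templates

-- A map on E(K n) is a symmetric function of two vertices whose values
-- on the diagonal are never used.

record Template (n ℓ : ℕ) : Set where
  field
    palette     : Fin n → Fin n → Subset ℓ
    palette-sym : ∀ u v → palette u v ≡ palette v u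
    nonempty    : ∀ u v → u ≢ v → Nonempty (palette u v)

open Template public

HasSDR : {q ℓ : ℕ} → (Fin q → Subset ℓ) → Set
HasSDR {q} {ℓ} A = Σ[ a ∈ (Fin q → Fin ℓ) ] Injective _≡_ _≡_ a × (∀ i → a i ∈ A i)

-- Copies of H in K n are the images of injective vertex maps.

SDRFree : Graph → {n ℓ : ℕ} → Template n ℓ → Set
SDRFree H {n} P = (f : Fin (order H) → Fin n) → Injective _≡_ _≡_ f →
  ¬ HasSDR λ i → palette P (f (proj₁ (ends H i))) (f (proj₂ (ends H i)))

weight : {n ℓ : ℕ} → Template n ℓ → ℝ
weight {n} P = Σℝ (map (λ (u , v) → log ∣ palette P u v ∣) (edges (K n)))

exlog : ℕ → Graph → ℕ → ℝ
exlog n H ℓ = sup λ ((P , _) : Σ[ P ∈ Template n ℓ ] SDRFree H P) → weight P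

λ[_,_] : Graph → ℕ → ℝ
λ[ H , ℓ ] = inf λ ((n , _) : Σ[ n ∈ ℕ ] order H ℕ.≤ n) →
  exlog n H ℓ ÷ fromℚ (ℕ⇒ℚ (n C 2))

{-# OPTIONS --safe #-}

-- Upper bound: in an H-SDR-free template the graph of the edges with at least
-- e(H) colours contains no copy of H - e for any edge e, since colouring e
-- first and the other edges greedily would give an SDR.  By the Erdős–Stone
-- theorem it has density at most π₋(H) + o(1), and every other edge has at most
-- e(H) - 1 colours.
--
-- Lower bound: give the edges of a Turán graph with χⱼ(H) - 1 parts all ℓ
-- colours and the edges inside the parts only the first j colours.  An SDR on a
-- copy of H uses these j colours at most j times, so deleting at most j edges
-- of H would leave a graph properly coloured by the parts.
--
-- The limit and the equality case compare these bounds with log ℓ, which is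
-- located between two natural numbers i and i + 2 through the partial sums of
-- exp.

module Submission where

-- The infimum over n in `λ[ H , ℓ ]` makes the two bounds asymmetric. The lower bound must hold on
-- every K_n without error term, so the Turán colouring has at most C(n, 2) / (r + 1) monochromatic
-- pairs for each n exactly. For the upper bound one large n suffices, chosen after the target
-- rational q: the gap below q pays for the o(1) term, which is fixed as 2/M.
--
-- A real is known only through the rationals above it; there is no subtraction and no case split on
-- order. To prove x ≤ y, a rational q above y is shown to lie above x. Means of logarithms are
-- handled through rationals above each logarithm, and the one for the smaller logarithm is lowered
-- to the minimum of both where their order matters.
--
-- Dividing by log ℓ asks for a positive rational at most log ℓ, which an upper cut does not supply.
-- It is found by a finite computation, because all partial sums of exp at b are bounded by a single
-- partial sum at b + 1: beyond index 2b the terms halve, and the shift by one doubles the sum.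

module Counting where

  open import Data.Bool.Base using (Bool; true; false; _∧_; if_then_else_)
  open import Data.Fin.Base using (Fin; zero; suc; punchIn)
  import Data.Fin.Properties as Fin
  open import Data.Nat.Base
  open import Data.Nat.Properties
  open import Data.Product.Base using (∃-syntax; Σ-syntax; _×_; _,_)
  open import Data.Vec.Functional using (removeAt)
  open import Function.Base using (_∘_)
  open import Function.Definitions using (Injective)
  open import Relation.Binary.PropositionalEquality
  open import Relation.Nullary using (¬_; Dec; does; yes; no; contradiction)

  open import Algebra.Properties.Semiring.Sum +-*-semiring public
    using (sum; sum-syntax; sum-remove; sum-cong-≗; ∑-distrib-+; ∑-comm; *-distribˡ-sum; *-distribʳ-sum)

  does⇒ : ∀ {p} {P : Set p} (P? : Dec P) → does P? ≡ true → P
  does⇒ (yes p) _ = p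

  does-false⇒ : ∀ {p} {P : Set p} (P? : Dec P) → does P? ≡ false → ¬ P
  does-false⇒ (no ¬p) _ = ¬p

  ∧-true : ∀ {x y} → x ∧ y ≡ true → x ≡ true × y ≡ true
  ∧-true {true} eq = refl , eq

  ⟦_⟧ : Bool → ℕ
  ⟦ b ⟧ = if b then 1 else 0

  count : ∀ {n} → (Fin n → Bool) → ℕ
  count p = sum (⟦_⟧ ∘ p)

  sum-mono-≤ : ∀ {n} {f g : Fin n → ℕ} → (∀ i → f i ≤ g i) → sum f ≤ sum g
  sum-mono-≤ {zero}  f≤g = z≤n
  sum-mono-≤ {suc n} f≤g = +-mono-≤ (f≤g zero) (sum-mono-≤ (f≤g ∘ suc))

  sum-const : ∀ n c → sum {n} (λ _ → c) ≡ n * c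
  sum-const zero    c = refl
  sum-const (suc n) c = cong (c +_) (sum-const n c)

  sum≤ : ∀ {n} {f : Fin n → ℕ} c → (∀ i → f i ≤ c) → sum f ≤ n * c
  sum≤ {n} c f≤c = ≤-trans (sum-mono-≤ f≤c) (≤-reflexive (sum-const n c))

  ⟦⟧≤1 : ∀ b → ⟦ b ⟧ ≤ 1
  ⟦⟧≤1 true  = ≤-refl
  ⟦⟧≤1 false = z≤n

  count≤ : ∀ {n} (p : Fin n → Bool) → count p ≤ n
  count≤ {n} p = ≤-trans (sum≤ 1 (⟦⟧≤1 ∘ p)) (≤-reflexive (*-identityʳ n))

  enumerate : ∀ {n} (p : Fin n → Bool) {t} → t ≤ count p →
    Σ[ f ∈ (Fin t → Fin n) ] Injective _≡_ _≡_ f × (∀ i → p (f i) ≡ true)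
  enumerate {zero}  p z≤n = (λ ()) , (λ {}) , λ ()
  enumerate {suc n} p t≤ with p zero in eq
  enumerate {suc n} p z≤n       | true = (λ ()) , (λ {}) , λ ()
  enumerate {suc n} p (s≤s t≤)  | true =
    let f , inj , pf = enumerate (p ∘ suc) t≤ in
    (λ { zero → zero ; (suc i) → suc (f i) }) ,
    (λ { {zero} {zero} _ → refl ; {suc i} {suc j} fi≡fj → cong suc (inj (Fin.suc-injective fi≡fj)) }) ,
    (λ { zero → eq ; (suc i) → pf i })
  enumerate {suc n} p t≤        | false =
    let f , inj , pf = enumerate (p ∘ suc) t≤ in
    suc ∘ f , inj ∘ Fin.suc-injective , pf

  some-above-average : ∀ {n} (f : Fin n → ℕ) c → n * c < sum f → ∃[ i ] c < f i
  some-above-average f c nc<Σf with Fin.any? (λ i → c <? f i)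
  ... | yes ∃i = ∃i
  ... | no ∄i  = contradiction nc<Σf (≤⇒≯ (sum≤ c λ i → ≮⇒≥ λ c<fi → ∄i (i , c<fi)))

  -- If every `suc n * f i` exceeded `sum f`, adding over i would give (n + 1)(sum f + 1) ≤ (n + 1)
  -- sum f. The product form avoids division.
  some-below-average : ∀ {n} (f : Fin (suc n) → ℕ) → ∃[ i ] suc n * f i ≤ sum f
  some-below-average {n} f with Fin.any? (λ i → suc n * f i ≤? sum f)
  ... | yes ∃i = ∃i
  ... | no ∄i  = contradiction bound (<⇒≱ (*-monoʳ-< (suc n) ≤-refl))
    where
    open ≤-Reasoning
    bound : suc n * suc (sum f) ≤ suc n * sum f
    bound = begin
      suc n * suc (sum f)                  ≡⟨ sum-const (suc n) (suc (sum f)) ⟨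
      sum {suc n} (λ _ → suc (sum f))      ≤⟨ sum-mono-≤ (λ i → ≰⇒> λ ≤ → ∄i (i , ≤)) ⟩
      sum (λ i → suc n * f i)              ≡⟨ *-distribˡ-sum (suc n) f ⟨
      suc n * sum f                        ∎

  sum-zero : ∀ n → sum {n} (λ _ → 0) ≡ 0
  sum-zero n = trans (sum-const n 0) (*-zeroʳ n)

  count-≟ : ∀ {n} (x : Fin n) → count (λ c → does (x Fin.≟ c)) ≡ 1
  count-≟ {suc n} zero    = cong suc (sum-zero n)
  count-≟ {suc n} (suc x) = count-≟ x

  sum-fibres : ∀ {n m} (p : Fin n → Bool) (f : Fin n → Fin m) →
    ∑[ c < m ] count (λ v → p v ∧ does (f v Fin.≟ c)) ≡ count p
  sum-fibres {n} {m} p f = trans (∑-comm (λ c v → ⟦ p v ∧ does (f v Fin.≟ c) ⟧)) (sum-cong-≗ fibre)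
    where
    fibre : ∀ v → ∑[ c < m ] ⟦ p v ∧ does (f v Fin.≟ c) ⟧ ≡ ⟦ p v ⟧
    fibre v with p v
    ... | true  = count-≟ (f v)
    ... | false = sum-zero m

  pigeonhole : ∀ {n m} (p : Fin n → Bool) (f : Fin n → Fin m) t → m * t < count p →
    ∃[ c ] t < count (λ v → p v ∧ does (f v Fin.≟ c))
  pigeonhole p f t mt<p = some-above-average _ t (<-≤-trans mt<p (≤-reflexive (sym (sum-fibres p f))))

  sum-one-small : ∀ {n} (f : Fin (suc n) → ℕ) {s t} → (∀ i → f i ≤ s) → ∀ i → f i ≤ t → sum f ≤ n * s + t
  sum-one-small {n} f {s} {t} f≤s i fi≤t = begin
    sum f                        ≡⟨ sum-remove {i = i} f ⟩
    f i + sum (removeAt f i)     ≤⟨ +-mono-≤ fi≤t (sum≤ {f = removeAt f i} s λ j → f≤s (punchIn i j)) ⟩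
    t + n * s                    ≡⟨ +-comm t (n * s) ⟩
    n * s + t                    ∎
    where open ≤-Reasoning

-- The Erdős-Stone theorem, by common neighbourhoods and vertex deletion.

module ErdosStone where

  open Counting
  open import Data.Bool.Base using (Bool; true; false; _∧_)
  open import Data.Fin.Base using (Fin; zero; suc; punchIn; inject≤; combine; remQuot; finToFun; funToFin)
  import Data.Fin.Properties as Fin
  open import Data.Nat.Base
  open import Data.Nat.Properties
  open import Data.Nat.Tactic.RingSolver using (solve-∀)
  open import Data.Product.Base using (∃-syntax; Σ-syntax; _×_; _,_; proj₁; proj₂)
  open import Function.Base using (_∘_)
  open import Function.Definitions using (Injective)
  open import Relation.Binary.PropositionalEquality
  open import Relation.Nullary using (¬_; Dec; does; yes; no; contradiction)

  module _ {n} (a : Fin n → Fin n → Bool) where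

    deg : Fin n → ℕ
    deg u = count (a u)

    -- twice the number of edges
    total : ℕ
    total = sum deg

    -- K_r(t) as a subgraph.  Its parts may span edges, and they are disjoint
    -- because a loopless graph has no edge between two copies of one vertex.
    record Blowup (r t : ℕ) : Set where
      field
        vertex    : Fin r → Fin t → Fin n
        injective : ∀ i → Injective _≡_ _≡_ (vertex i)
        adjacent  : ∀ i j → i ≢ j → ∀ x y → a (vertex i x) (vertex j y) ≡ true

  open Blowup

  toFin₂ : Bool → Fin 2
  toFin₂ false = zero
  toFin₂ true  = suc zero

  toFin₂-injective : ∀ {b c} → toFin₂ b ≡ toFin₂ c → b ≡ c
  toFin₂-injective {false} {false} _ = refl
  toFin₂-injective {true}  {true}  _ = refl

  -- One step of the induction on the number of parts: a vertex is good if it has t neighbours in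
  -- every part of B, and good vertices with the same neighbourhood in B supply the next part.
  module Extend {n} (a : Fin n → Fin n → Bool) (sym-a : ∀ u v → a u v ≡ a v u)
    {r s} (B : Blowup a r s) where

    neighbours : Fin n → Fin r → ℕ
    neighbours w i = count λ x → a (vertex B i x) w

    good? : ∀ t w → Dec (∀ i → t ≤ neighbours w i)
    good? t w = Fin.all? λ i → t ≤? neighbours w i

    good : ℕ → Fin n → Bool
    good t w = does (good? t w)

    bad⇒ : ∀ t w → good t w ≡ false → ∃[ i ] neighbours w i < t
    bad⇒ t w bad with Fin.¬∀⟶∃¬ _ _ (λ i → t ≤? neighbours w i) (does-false⇒ (good? t w) bad)
    ... | i , t≰ = i , ≰⇒> t≰

    -- The whole neighbourhood of w in B as one of 2^(rs) codes, so that the pigeonhole principle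
    -- applies to it.
    pattern-of : Fin n → Fin (2 ^ (r * s))
    pattern-of w = funToFin λ k → let i , x = remQuot {r} s k in toFin₂ (a (vertex B i x) w)

    pattern-adjacent : ∀ {w w′} → pattern-of w ≡ pattern-of w′ → ∀ i x → a (vertex B i x) w ≡ a (vertex B i x) w′
    pattern-adjacent {w} {w′} eq i x = toFin₂-injective (begin
      toFin₂ (a (vertex B i x) w)       ≡⟨ decode w ⟨
      finToFun (pattern-of w) (combine i x)   ≡⟨ cong (λ c → finToFun c (combine i x)) eq ⟩
      finToFun (pattern-of w′) (combine i x)  ≡⟨ decode w′ ⟩
      toFin₂ (a (vertex B i x) w′)      ∎)
      where
      open ≡-Reasoning
      decode : ∀ w → finToFun (pattern-of w) (combine i x) ≡ toFin₂ (a (vertex B i x) w)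
      decode w = trans (Fin.finToFun-funToFin (λ k → let i , x = remQuot {r} s k in toFin₂ (a (vertex B i x) w)) (combine i x))
        (cong (λ (i , x) → toFin₂ (a (vertex B i x) w)) (Fin.remQuot-combine i x))

    class : ℕ → Fin (2 ^ (r * s)) → Fin n → Bool
    class t c w = good t w ∧ does (pattern-of w Fin.≟ c)

    -- Members of one class have the same neighbours in B, so the t neighbours that one member has
    -- in each old part are adjacent to all members.
    extend-class : ∀ t c → t < count (class t c) → Blowup a (suc r) t
    extend-class t c t<class = record
      { vertex    = λ { zero → h ; (suc i) → vertex B i ∘ g i }
      ; injective = λ { zero → h-inj ; (suc i) → g-inj i ∘ injective B i }
      ; adjacent  = λ
        { zero    zero    0≢0 → contradiction refl 0≢0
        ; zero    (suc j) _   → λ x y → trans (sym-a (h x) _) (g∼h j y x)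
        ; (suc i) zero    _   → g∼h i
        ; (suc i) (suc j) i≢j → λ x y → adjacent B i j (i≢j ∘ cong suc) _ _
        }
      }
      where
      members = enumerate (class t c) (<⇒≤ t<class)

      h : Fin t → Fin n
      h = proj₁ members

      h-inj : Injective _≡_ _≡_ h
      h-inj = proj₁ (proj₂ members)

      -- The strict inequality gives a member even for t = 0; its neighbourhood stands for the
      -- class.
      w₀ : Fin n
      w₀ = proj₁ (enumerate (class t c) t<class) zero

      w₀∈ : class t c w₀ ≡ true
      w₀∈ = proj₂ (proj₂ (enumerate (class t c) t<class)) zero

      pattern-in : ∀ w → class t c w ≡ true → pattern-of w ≡ c
      pattern-in w w∈ = does⇒ (pattern-of w Fin.≟ c) (proj₂ (∧-true {good t w} w∈))

      part : ∀ i → Σ[ f ∈ (Fin t → Fin s) ] Injective _≡_ _≡_ f × (∀ x → a (vertex B i (f x)) w₀ ≡ true)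
      part i = enumerate (λ x → a (vertex B i x) w₀) (does⇒ (good? t w₀) (proj₁ (∧-true w₀∈)) i)

      g : ∀ i → Fin t → Fin s
      g i = proj₁ (part i)

      g-inj : ∀ i → Injective _≡_ _≡_ (g i)
      g-inj i = proj₁ (proj₂ (part i))

      g∼h : ∀ i x y → a (vertex B i (g i x)) (h y) ≡ true
      g∼h i x y = trans
        (pattern-adjacent (trans (pattern-in (h y) (proj₂ (proj₂ members) y)) (sym (pattern-in w₀ w₀∈))) i (g i x))
        (proj₂ (proj₂ (part i)) x)

    extend : ∀ t → 2 ^ (r * s) * t < count (good t) → Blowup a (suc r) t
    extend t many = let c , t<class = pigeonhole (good t) pattern-of t many in extend-class t c t<class

  -- Double counting of the edges between the vertices of K_{1+r}(s) and all
  -- vertices: a vertex that is not good sends at most rs + t of them.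

  good-many : ∀ {n} (a : Fin n → Fin n → Bool) (sym-a : ∀ u v → a u v ≡ a v u)
    {r s} (B : Blowup a (suc r) s) t → let open Extend a sym-a B in
    ∑[ i < suc r ] ∑[ x < s ] deg a (vertex B i x) ≤ n * (r * s + t) + count (good t) * (suc r * s)
  good-many {n} a sym-a {r} {s} B t = begin
    ∑[ i < suc r ] ∑[ x < s ] ∑[ w < n ] ⟦ a (vertex B i x) w ⟧
      ≡⟨ sum-cong-≗ {suc r} (λ i → ∑-comm {s} λ x w → ⟦ a (vertex B i x) w ⟧) ⟩
    ∑[ i < suc r ] ∑[ w < n ] neighbours w i
      ≡⟨ ∑-comm {suc r} (λ i w → neighbours w i) ⟩
    ∑[ w < n ] sum (neighbours w)
      ≤⟨ sum-mono-≤ bound ⟩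
    ∑[ w < n ] (r * s + t + ⟦ good t w ⟧ * (suc r * s))
      ≡⟨ ∑-distrib-+ {n} (λ _ → r * s + t) (λ w → ⟦ good t w ⟧ * (suc r * s)) ⟩
    ∑[ w < n ] (r * s + t) + ∑[ w < n ] (⟦ good t w ⟧ * (suc r * s))
      ≡⟨ cong₂ _+_ (sum-const n _) (sym (*-distribʳ-sum (suc r * s) (⟦_⟧ ∘ good t))) ⟩
    n * (r * s + t) + count (good t) * (suc r * s) ∎
    where
    open ≤-Reasoning
    open Extend a sym-a B
    bound : ∀ w → sum (neighbours w) ≤ r * s + t + ⟦ good t w ⟧ * (suc r * s)
    bound w with good t w in eq
    ... | true  = ≤-trans (sum≤ s λ i → count≤ λ x → a (vertex B i x) w)
                    (≤-trans (≤-reflexive (sym (+-identityʳ (suc r * s)))) (m≤n+m _ (r * s + t)))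
    ... | false = let i , small = bad⇒ t w eq in
                  ≤-trans (sum-one-small (neighbours w) (λ i → count≤ λ x → a (vertex B i x) w) i (<⇒≤ small))
                    (m≤m+n _ _)

  -- The density 1 - 1/(1+R) + 1/M, as numerator / denominator.

  numerator denominator : ℕ → ℕ → ℕ
  numerator   R M = R * M + suc R
  denominator R M = suc R * M

  -- After the main terms cancel, the excess density 1/M leaves at least s/M = 2t per vertex. Bad
  -- vertices account for t of this, and good vertices must pay for the other t; hence s = 2Mt.
  good-count-bound : ∀ R M r t n g .{{_ : NonZero M}} .{{_ : NonZero t}} → r ≤ R →
    let s = 2 * M * t in
    suc r * s * (numerator R M * n) ≤ denominator R M * (n * (r * s + t) + g * (suc r * s)) →
    n ≤ g * suc r * (2 * M)
  good-count-bound R M r t n g r≤R hyp with m≤n⇒∃[o]m+o≡n r≤R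
  ... | d , refl = +-cancelˡ-≤ n _ _
    (*-cancelˡ-≤ (M * t) {{m*n≢0 M t}} (≤-trans (≤-reflexive (lhs₂ M t n))
      (≤-trans (*-cancelˡ-≤ (suc (r + d)) step) (≤-reflexive (rhs₂ M t n g r)))))
    where
    s = 2 * M * t
    lhs₁ : ∀ r d M s n → suc r * s * (((r + d) * M + suc (r + d)) * n) ≡
      suc (r + d) * M * (n * (r * s)) + s * n * (d * M + suc r * suc (r + d))
    lhs₁ = solve-∀
    rhs₁ : ∀ r d M s t n g → suc (r + d) * M * (n * (r * s + t) + g * (suc r * s)) ≡
      suc (r + d) * M * (n * (r * s)) + suc (r + d) * (M * (n * t + g * (suc r * s)))
    rhs₁ = solve-∀
    lhs₂ : ∀ M t n → M * t * (n + n) ≡ 2 * M * t * n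
    lhs₂ = solve-∀
    rhs₂ : ∀ M t n g r → M * (n * t + g * (suc r * (2 * M * t))) ≡ M * t * (n + g * suc r * (2 * M))
    rhs₂ = solve-∀
    open ≤-Reasoning
    step : suc (r + d) * (s * n) ≤ suc (r + d) * (M * (n * t + g * (suc r * s)))
    step = begin
      suc (r + d) * (s * n)                      ≡⟨ *-comm (suc (r + d)) (s * n) ⟩
      s * n * suc (r + d)                        ≤⟨ *-monoʳ-≤ (s * n) (≤-trans (m≤m+n _ (r * suc (r + d))) (m≤n+m _ (d * M))) ⟩
      s * n * (d * M + suc r * suc (r + d))      ≤⟨ +-cancelˡ-≤ (suc (r + d) * M * (n * (r * s))) _ _
                                                     (subst₂ _≤_ (lhs₁ r d M s n) (rhs₁ r d M s t n g) hyp) ⟩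
      suc (r + d) * (M * (n * t + g * (suc r * s))) ∎

  MinDegree : ∀ {n} → ℕ → ℕ → (Fin n → Fin n → Bool) → Set
  MinDegree {n} R M a = ∀ u → numerator R M * n ≤ denominator R M * deg a u

  -- Induction on r, with parts of size 2Mt requested at the previous level. `good-count-bound`
  -- bounds n by a constant times the number of good vertices, so a large n forces more than L of
  -- them, which is t for each neighbourhood code.
  minDegree-blowup : ∀ R M .{{_ : NonZero M}} r → r ≤ suc R → ∀ t .{{_ : NonZero t}} → ∃[ N ] ∀ n → N ≤ n →
    (a : Fin n → Fin n → Bool) → (∀ u v → a u v ≡ a v u) → MinDegree R M a → Blowup a (suc r) t
  minDegree-blowup R M zero r≤R t = t , λ n t≤n a sym-a δ → record
    { vertex    = λ _ x → inject≤ x t≤n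
    ; injective = λ _ → Fin.inject≤-injective t≤n t≤n _ _
    ; adjacent  = λ { zero zero 0≢0 → contradiction refl 0≢0 }
    }
  minDegree-blowup R M (suc r) (s≤s r≤R) t = N ⊔ suc (L * suc r * (2 * M)) , λ n N≤n a sym-a δ →
    let open Extend a sym-a (blowup n (m⊔n≤o⇒m≤o N _ N≤n) a sym-a δ) in
    extend t (many n (m⊔n≤o⇒n≤o N _ N≤n) a sym-a δ (blowup n (m⊔n≤o⇒m≤o N _ N≤n) a sym-a δ))
    where
    s = 2 * M * t
    instance
      s≢0 : NonZero s
      s≢0 = m*n≢0 (2 * M) t {{m*n≢0 2 M}}
    L = 2 ^ (suc r * s) * t
    N = proj₁ (minDegree-blowup R M r (m≤n⇒m≤1+n r≤R) s)
    blowup = proj₂ (minDegree-blowup R M r (m≤n⇒m≤1+n r≤R) s)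
    many : ∀ n → L * suc r * (2 * M) < n → (a : Fin n → Fin n → Bool) (sym-a : ∀ u v → a u v ≡ a v u) → MinDegree R M a →
      (B : Blowup a (suc r) s) → L < count (Extend.good a sym-a B t)
    many n L<n a sym-a δ B = ≰⇒> λ g≤L → <⇒≱ L<n (≤-trans
      (good-count-bound R M r t n (count (Extend.good a sym-a B t)) r≤R double-count)
      (*-monoˡ-≤ (2 * M) (*-monoˡ-≤ (suc r) g≤L)))
      where
      open ≤-Reasoning
      D = denominator R M
      double-count : suc r * s * (numerator R M * n) ≤
        D * (n * (r * s + t) + count (Extend.good a sym-a B t) * (suc r * s))
      double-count = begin
        suc r * s * (numerator R M * n)
          ≡⟨ *-assoc (suc r) s _ ⟩
        suc r * (s * (numerator R M * n))
          ≡⟨ trans (sum-cong-≗ {suc r} λ _ → sum-const s (numerator R M * n)) (sum-const (suc r) _) ⟨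
        ∑[ i < suc r ] ∑[ x < s ] (numerator R M * n)
          ≤⟨ sum-mono-≤ {suc r} (λ i → sum-mono-≤ {s} λ x → δ (vertex B i x)) ⟩
        ∑[ i < suc r ] ∑[ x < s ] (D * deg a (vertex B i x))
          ≡⟨ trans (*-distribˡ-sum D (λ i → ∑[ x < s ] deg a (vertex B i x)))
               (sum-cong-≗ {suc r} λ i → *-distribˡ-sum D (deg a ∘ vertex B i)) ⟨
        D * ∑[ i < suc r ] ∑[ x < s ] deg a (vertex B i x)
          ≤⟨ *-monoʳ-≤ (D) (good-many a sym-a B t) ⟩
        D * (n * (r * s + t) + count (Extend.good a sym-a B t) * (suc r * s)) ∎

  -- Deleting v removes its row and its column. By symmetry each contributes `deg a v`, the diagonal
  -- entry being `false`.
  total-remove : ∀ {n} (a : Fin (suc n) → Fin (suc n) → Bool) → (∀ u v → a u v ≡ a v u) →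
    ∀ v → a v v ≡ false → total a ≡ total (λ x y → a (punchIn v x) (punchIn v y)) + 2 * deg a v
  total-remove {n} a sym-a v avv = begin
    total a
      ≡⟨ sum-remove {i = v} (deg a) ⟩
    deg a v + ∑[ x < n ] deg a (punchIn v x)
      ≡⟨ cong (deg a v +_) (trans (sum-cong-≗ {n} λ x → sum-remove {i = v} (⟦_⟧ ∘ a (punchIn v x)))
           (∑-distrib-+ {n} (λ x → ⟦ a (punchIn v x) v ⟧) (λ x → deg a′ x))) ⟩
    deg a v + (∑[ x < n ] ⟦ a (punchIn v x) v ⟧ + total a′)
      ≡⟨ cong (λ d → deg a v + (d + total a′)) column ⟩
    deg a v + (deg a v + total a′)
      ≡⟨ rearrange (deg a v) (total a′) ⟩
    total a′ + 2 * deg a v ∎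
    where
    open ≡-Reasoning
    a′ : Fin n → Fin n → Bool
    a′ x y = a (punchIn v x) (punchIn v y)
    rearrange : ∀ d t → d + (d + t) ≡ t + 2 * d
    rearrange = solve-∀
    column : ∑[ x < n ] ⟦ a (punchIn v x) v ⟧ ≡ deg a v
    column = begin
      ∑[ x < n ] ⟦ a (punchIn v x) v ⟧               ≡⟨ sum-cong-≗ (λ x → cong ⟦_⟧ (sym-a (punchIn v x) v)) ⟩
      ∑[ x < n ] ⟦ a v (punchIn v x) ⟧               ≡⟨ cong (λ b → ⟦ b ⟧ + ∑[ x < n ] ⟦ a v (punchIn v x) ⟧) avv ⟨
      ⟦ a v v ⟧ + ∑[ x < n ] ⟦ a v (punchIn v x) ⟧   ≡⟨ sum-remove {i = v} (⟦_⟧ ∘ a v) ⟨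
      deg a v                                        ∎

  total≤ : ∀ {n} (a : Fin n → Fin n → Bool) → total a ≤ n * n
  total≤ {n} a = sum≤ n λ u → count≤ (a u)

  pullback : ∀ {m n r t} {a : Fin n → Fin n → Bool} (f : Fin m → Fin n) → Injective _≡_ _≡_ f →
    Blowup (λ x y → a (f x) (f y)) r t → Blowup a r t
  pullback f f-inj B = record
    { vertex    = λ i → f ∘ vertex B i
    ; injective = λ i → injective B i ∘ f-inj
    ; adjacent  = adjacent B
    }

  -- Vertices of degree less than the density times the current order are
  -- deleted one at a time.

  prune : ∀ R M .{{_ : NonZero M}} t .{{_ : NonZero t}} → ∃[ N ] ∀ n →
    (a : Fin n → Fin n → Bool) → (∀ u v → a u v ≡ a v u) → (∀ u → a u u ≡ false) →
    numerator R M * (n * suc n) + denominator R M * (N * N) < denominator R M * total a →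
    Blowup a (suc (suc R)) t
  prune R M t = N , go
    where
    D = denominator R M
    N = proj₁ (minDegree-blowup R M (suc R) ≤-refl t)
    go : ∀ n → (a : Fin n → Fin n → Bool) → (∀ u v → a u v ≡ a v u) → (∀ u → a u u ≡ false) →
      numerator R M * (n * suc n) + D * (N * N) < D * total a → Blowup a (suc (suc R)) t
    go n a sym-a irr-a dense with N ≤? n
    -- The summand D · N² stops the deletions in time: below N vertices the total is at most N².
    ... | no N≰n = contradiction dense (≤⇒≯ (≤-trans
            (*-monoʳ-≤ D (≤-trans (total≤ a) (*-mono-≤ (≰⇒≥ N≰n) (≰⇒≥ N≰n)))) (m≤n+m _ _)))
    ... | yes N≤n with Fin.any? (λ u → D * deg a u <? numerator R M * n)
    ...   | no ∄low = proj₂ (minDegree-blowup R M (suc R) ≤-refl t) n N≤n a sym-a λ u → ≮⇒≥ λ low → ∄low (u , low)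
    -- Since (n + 1)(n + 2) - n(n + 1) = 2(n + 1), the threshold falls by 2 · numerator · (n + 1),
    -- while D · total falls only by 2 · D · deg v, which is less. The surplus survives.
    go (suc n) a sym-a irr-a dense | yes _ | yes (v , low) =
      pullback (punchIn v) (Fin.punchIn-injective v _ _)
        (go n a′ (λ x y → sym-a _ _) (λ x → irr-a _)
          (+-cancelʳ-< (D * (2 * deg a v)) _ _ (begin-strict
            numerator R M * (n * suc n) + D * (N * N) + D * (2 * deg a v)
              ≡⟨ lhs D (deg a v) _ ⟩
            numerator R M * (n * suc n) + D * (N * N) + 2 * (D * deg a v)
              ≤⟨ +-monoʳ-≤ (numerator R M * (n * suc n) + D * (N * N)) (*-monoʳ-≤ 2 (<⇒≤ low)) ⟩
            numerator R M * (n * suc n) + D * (N * N) + 2 * (numerator R M * suc n)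
              ≡⟨ rhs (numerator R M) n (D * (N * N)) ⟩
            numerator R M * (suc n * suc (suc n)) + D * (N * N)
              <⟨ dense ⟩
            D * total a
              ≡⟨ trans (cong (D *_) (total-remove a sym-a v (irr-a v))) (*-distribˡ-+ D _ _) ⟩
            D * total a′ + D * (2 * deg a v) ∎)))
      where
      open ≤-Reasoning
      a′ : Fin n → Fin n → Bool
      a′ x y = a (punchIn v x) (punchIn v y)
      lhs : ∀ D d x → x + D * (2 * d) ≡ x + 2 * (D * d)
      lhs = solve-∀
      rhs : ∀ B n x → B * (n * suc n) + x + 2 * (B * suc n) ≡ B * (suc n * suc (suc n)) + x
      rhs = solve-∀

  -- The slack 1/M of `prune` becomes 2/M: on m vertices m(m + 1) exceeds m(m - 1) by 2m, and this
  -- together with D · N² grows at most linearly, so the second 1/M absorbs it for large m.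
  erdős-stone : ∀ R M .{{_ : NonZero M}} t .{{_ : NonZero t}} → ∃[ N ] ∀ n → N ≤ n →
    (a : Fin (suc n) → Fin (suc n) → Bool) → (∀ u v → a u v ≡ a v u) → (∀ u → a u u ≡ false) →
    ¬ Blowup a (suc (suc R)) t → suc R * M * total a ≤ (R * M + 2 * suc R) * (suc n * n)
  erdős-stone R M t with prune R M t
  ... | N , dense⇒blowup = 2 * B + D * (N * N) , λ n large a sym-a irr-a free →
    ≤-trans (≮⇒≥ (free ∘ dense⇒blowup (suc n) a sym-a irr-a)) (begin
      B * (suc n * suc (suc n)) + D * (N * N)
        ≡⟨ split B n (D * (N * N)) ⟩
      B * (suc n * n) + (2 * B * suc n + D * (N * N))
        ≤⟨ +-monoʳ-≤ (B * (suc n * n)) (+-monoʳ-≤ (2 * B * suc n) (m≤m*n (D * (N * N)) (suc n))) ⟩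
      B * (suc n * n) + (2 * B * suc n + D * (N * N) * suc n)
        ≡⟨ cong (B * (suc n * n) +_) (trans (sym (*-distribʳ-+ (suc n) (2 * B) _)) (*-comm _ (suc n))) ⟩
      B * (suc n * n) + suc n * (2 * B + D * (N * N))
        ≤⟨ +-monoʳ-≤ (B * (suc n * n)) (≤-trans (*-monoʳ-≤ (suc n) large) (m≤n*m _ (suc R))) ⟩
      B * (suc n * n) + suc R * (suc n * n)
        ≡⟨ merge R M (suc n * n) ⟩
      (R * M + 2 * suc R) * (suc n * n) ∎)
    where
    open ≤-Reasoning
    B = numerator R M
    D = denominator R M
    split : ∀ B n x → B * (suc n * suc (suc n)) + x ≡ B * (suc n * n) + (2 * B * suc n + x)
    split = solve-∀
    merge : ∀ R M x → (R * M + suc R) * x + suc R * x ≡ (R * M + 2 * suc R) * x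
    merge = solve-∀

-- Rational inequalities and the embedding of the naturals.

module Rationals where

  open import Data.Integer.Base using (+_; +≤+; +<+)
  import Data.Integer.Base as ℤ
  import Data.Integer.Properties as ℤ
  open import Data.Integer.Tactic.RingSolver using (solve-∀)
  open import Data.Nat.Base as ℕ using (ℕ; suc)
  import Data.Nat.Properties as ℕ
  open import Data.Product.Base using (∃-syntax; _,_)
  open import Data.Rational.Base
  open import Data.Rational.Properties
  open import Data.Rational.Unnormalised.Base as ℚᵘ using (mkℚᵘ; *≡*; *≤*; *<*) renaming (_≃_ to _≃ᵘ_)
  import Data.Rational.Unnormalised.Properties as ℚᵘ
  open import Defs using (ℕ⇒ℚ)
  open import Relation.Binary.PropositionalEquality

  *-monoˡ-≤ : ∀ {r p q} → 0ℚ ≤ r → p ≤ q → r * p ≤ r * q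
  *-monoˡ-≤ {r} 0≤r = *-monoˡ-≤-nonNeg r {{nonNegative 0≤r}}

  *-monoʳ-≤ : ∀ {r p q} → 0ℚ ≤ r → p ≤ q → p * r ≤ q * r
  *-monoʳ-≤ {r} 0≤r = *-monoʳ-≤-nonNeg r {{nonNegative 0≤r}}

  *-monoˡ-< : ∀ {r p q} → 0ℚ < r → p < q → r * p < r * q
  *-monoˡ-< {r} 0<r = *-monoʳ-<-pos r {{positive 0<r}}

  *-cancelˡ-≤ : ∀ {r p q} → 0ℚ < r → r * p ≤ r * q → p ≤ q
  *-cancelˡ-≤ {r} 0<r = *-cancelˡ-≤-pos r {{positive 0<r}}

  0≤* : ∀ {p q} → 0ℚ ≤ p → 0ℚ ≤ q → 0ℚ ≤ p * q
  0≤* {p} 0≤p 0≤q = ≤-trans (≤-reflexive (sym (*-zeroʳ p))) (*-monoˡ-≤ 0≤p 0≤q)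

  0≤+ : ∀ {p q} → 0ℚ ≤ p → 0ℚ ≤ q → 0ℚ ≤ p + q
  0≤+ = +-mono-≤

  p≤q+p : ∀ {p q} → 0ℚ ≤ q → p ≤ q + p
  p≤q+p {p} 0≤q = ≤-trans (≤-reflexive (sym (+-identityˡ p))) (+-monoˡ-≤ p 0≤q)

  p≤p+q : ∀ {p q} → 0ℚ ≤ q → p ≤ p + q
  p≤p+q {p} {q} 0≤q = ≤-trans (p≤q+p 0≤q) (≤-reflexive (+-comm q p))

  p<p+q : ∀ {p q} → 0ℚ < q → p < p + q
  p<p+q {p} 0<q = ≤-<-trans (≤-reflexive (sym (+-identityʳ p))) (+-monoʳ-< p 0<q)

  toℚᵘ-ℕ⇒ℚ : ∀ n → toℚᵘ (ℕ⇒ℚ n) ≃ᵘ mkℚᵘ (+ n) 0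
  toℚᵘ-ℕ⇒ℚ n = toℚᵘ-fromℚᵘ (mkℚᵘ (+ n) 0)

  ℕ⇒ℚ-+ : ∀ m n → ℕ⇒ℚ (m ℕ.+ n) ≡ ℕ⇒ℚ m + ℕ⇒ℚ n
  ℕ⇒ℚ-+ m n = toℚᵘ-injective (begin
    toℚᵘ (ℕ⇒ℚ (m ℕ.+ n))                 ≈⟨ toℚᵘ-ℕ⇒ℚ (m ℕ.+ n) ⟩
    mkℚᵘ (+ (m ℕ.+ n)) 0                 ≈⟨ *≡* (trans (cong (ℤ._* ℤ.1ℤ) (ℤ.pos-+ m n)) (arith (+ m) (+ n))) ⟩
    mkℚᵘ (+ m) 0 ℚᵘ.+ mkℚᵘ (+ n) 0       ≈⟨ ℚᵘ.+-cong (toℚᵘ-ℕ⇒ℚ m) (toℚᵘ-ℕ⇒ℚ n) ⟨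
    toℚᵘ (ℕ⇒ℚ m) ℚᵘ.+ toℚᵘ (ℕ⇒ℚ n)       ≈⟨ toℚᵘ-homo-+ (ℕ⇒ℚ m) (ℕ⇒ℚ n) ⟨
    toℚᵘ (ℕ⇒ℚ m + ℕ⇒ℚ n)                 ∎)
    where
    open ℚᵘ.≃-Reasoning
    arith : ∀ m n → (m ℤ.+ n) ℤ.* ℤ.1ℤ ≡ (m ℤ.* ℤ.1ℤ ℤ.+ n ℤ.* ℤ.1ℤ) ℤ.* ℤ.1ℤ
    arith = solve-∀

  ℕ⇒ℚ-* : ∀ m n → ℕ⇒ℚ (m ℕ.* n) ≡ ℕ⇒ℚ m * ℕ⇒ℚ n
  ℕ⇒ℚ-* m n = toℚᵘ-injective (begin
    toℚᵘ (ℕ⇒ℚ (m ℕ.* n))                 ≈⟨ toℚᵘ-ℕ⇒ℚ (m ℕ.* n) ⟩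
    mkℚᵘ (+ (m ℕ.* n)) 0                 ≈⟨ *≡* (cong (ℤ._* ℤ.1ℤ) (ℤ.pos-* m n)) ⟩
    mkℚᵘ (+ m) 0 ℚᵘ.* mkℚᵘ (+ n) 0       ≈⟨ ℚᵘ.*-cong (toℚᵘ-ℕ⇒ℚ m) (toℚᵘ-ℕ⇒ℚ n) ⟨
    toℚᵘ (ℕ⇒ℚ m) ℚᵘ.* toℚᵘ (ℕ⇒ℚ n)       ≈⟨ toℚᵘ-homo-* (ℕ⇒ℚ m) (ℕ⇒ℚ n) ⟨
    toℚᵘ (ℕ⇒ℚ m * ℕ⇒ℚ n)                 ∎)
    where open ℚᵘ.≃-Reasoning

  ℕ⇒ℚ-mono-≤ : ∀ {m n} → m ℕ.≤ n → ℕ⇒ℚ m ≤ ℕ⇒ℚ n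
  ℕ⇒ℚ-mono-≤ {m} {n} m≤n = toℚᵘ-cancel-≤
    (ℚᵘ.≤-respˡ-≃ (ℚᵘ.≃-sym (toℚᵘ-ℕ⇒ℚ m)) (ℚᵘ.≤-respʳ-≃ (ℚᵘ.≃-sym (toℚᵘ-ℕ⇒ℚ n))
      (*≤* (ℤ.*-monoʳ-≤-nonNeg ℤ.1ℤ (+≤+ m≤n)))))

  ℕ⇒ℚ-mono-< : ∀ {m n} → m ℕ.< n → ℕ⇒ℚ m < ℕ⇒ℚ n
  ℕ⇒ℚ-mono-< {m} {n} m<n = toℚᵘ-cancel-<
    (ℚᵘ.<-respˡ-≃ (ℚᵘ.≃-sym (toℚᵘ-ℕ⇒ℚ m)) (ℚᵘ.<-respʳ-≃ (ℚᵘ.≃-sym (toℚᵘ-ℕ⇒ℚ n))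
      (*<* (ℤ.*-monoʳ-<-pos ℤ.1ℤ (+<+ m<n)))))

  ℕ⇒ℚ-cancel-≤ : ∀ {m n} → ℕ⇒ℚ m ≤ ℕ⇒ℚ n → m ℕ.≤ n
  ℕ⇒ℚ-cancel-≤ m≤n = ℕ.≮⇒≥ λ n<m → <-irrefl refl (<-≤-trans (ℕ⇒ℚ-mono-< n<m) m≤n)

  0≤ℕ⇒ℚ : ∀ n → 0ℚ ≤ ℕ⇒ℚ n
  0≤ℕ⇒ℚ n = ℕ⇒ℚ-mono-≤ {0} {n} ℕ.z≤n

  0<ℕ⇒ℚ : ∀ n .{{_ : ℕ.NonZero n}} → 0ℚ < ℕ⇒ℚ n
  0<ℕ⇒ℚ n = ℕ⇒ℚ-mono-< {0} {n} (ℕ.>-nonZero⁻¹ n)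

  toℚᵘ-/ : ∀ n → toℚᵘ (+ 1 / suc n) ≃ᵘ mkℚᵘ (+ 1) n
  toℚᵘ-/ n = toℚᵘ-fromℚᵘ (mkℚᵘ (+ 1) n)

  *-recip : ∀ n .{{_ : ℕ.NonZero n}} → ℕ⇒ℚ n * (+ 1 / n) ≡ 1ℚ
  *-recip (suc n) = toℚᵘ-injective (begin
    toℚᵘ (ℕ⇒ℚ (suc n) * (+ 1 / suc n))            ≈⟨ toℚᵘ-homo-* (ℕ⇒ℚ (suc n)) (+ 1 / suc n) ⟩
    toℚᵘ (ℕ⇒ℚ (suc n)) ℚᵘ.* toℚᵘ (+ 1 / suc n)    ≈⟨ ℚᵘ.*-cong (toℚᵘ-ℕ⇒ℚ (suc n)) (toℚᵘ-/ n) ⟩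
    mkℚᵘ (+ suc n) 0 ℚᵘ.* mkℚᵘ (+ 1) n            ≈⟨ *≡* (arith (+ suc n)) ⟩
    mkℚᵘ (+ 1) 0                                  ∎)
    where
    open ℚᵘ.≃-Reasoning
    arith : ∀ n → (n ℤ.* ℤ.1ℤ) ℤ.* ℤ.1ℤ ≡ ℤ.1ℤ ℤ.* (ℤ.1ℤ ℤ.* n)
    arith = solve-∀

  0<recip : ∀ n .{{_ : ℕ.NonZero n}} → 0ℚ < + 1 / n
  0<recip n = positive⁻¹ (+ 1 / n) {{normalize-pos 1 n}}

  archimedean : ∀ p → ∃[ n ] p ≤ ℕ⇒ℚ n
  archimedean p@record{} = ℤ.∣ ↥ p ∣ , toℚᵘ-cancel-≤ (ℚᵘ.≤-respʳ-≃ (ℚᵘ.≃-sym (toℚᵘ-ℕ⇒ℚ ℤ.∣ ↥ p ∣)) (*≤* bound))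
    where
    open ℤ.≤-Reasoning
    i≤∣i∣ : ∀ i → i ℤ.≤ + ℤ.∣ i ∣
    i≤∣i∣ (+ n)      = ℤ.≤-refl
    i≤∣i∣ ℤ.-[1+ n ] = ℤ.-≤+
    bound : ↥ p ℤ.* ℤ.1ℤ ℤ.≤ + ℤ.∣ ↥ p ∣ ℤ.* ↧ p
    bound = begin
      ↥ p ℤ.* ℤ.1ℤ              ≡⟨ ℤ.*-identityʳ (↥ p) ⟩
      ↥ p                       ≤⟨ i≤∣i∣ (↥ p) ⟩
      + ℤ.∣ ↥ p ∣               ≤⟨ +≤+ (ℕ.m≤m*n ℤ.∣ ↥ p ∣ (↧ₙ p)) ⟩
      + (ℤ.∣ ↥ p ∣ ℕ.* ↧ₙ p)    ≡⟨ ℤ.pos-* ℤ.∣ ↥ p ∣ (↧ₙ p) ⟩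
      + ℤ.∣ ↥ p ∣ ℤ.* ↧ p       ∎

-- Partial sums of the exponential series.

module Exponential where

  import Data.Integer.Base as ℤ
  open import Data.Nat.Base as ℕ using (ℕ; zero; suc; _!)
  import Data.Nat.Properties as ℕ
  open import Data.Product.Base using (∃-syntax; _,_)
  open import Data.Rational.Base
  open import Data.Rational.Properties
  open import Data.Rational.Solver using (module +-*-Solver)
  open import Algebra.Definitions.RawSemiring +-*-rawSemiring using (_^_)
  open import Defs using (ℕ⇒ℚ; expSum)
  open Rationals
  open import Relation.Binary.PropositionalEquality
  open +-*-Solver

  recip! : ℕ → ℚ
  recip! k = _/_ (ℤ.+ 1) (k !) {{ℕ._!≢0 k}}

  term : ℕ → ℚ → ℚ
  term k p = p ^ k * recip! k

  recip!-suc : ∀ k → ℕ⇒ℚ (suc k) * recip! (suc k) ≡ recip! k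
  recip!-suc k = begin
    n * y                ≡⟨ *-identityʳ (n * y) ⟨
    n * y * 1ℚ           ≡⟨ cong (n * y *_) (*-recip (k !) {{ℕ._!≢0 k}}) ⟨
    n * y * (m * x)      ≡⟨ solve 4 (λ n y m x → n :* y :* (m :* x) := x :* (n :* m :* y)) refl n y m x ⟩
    x * (n * m * y)      ≡⟨ cong (λ z → x * (z * y)) (ℕ⇒ℚ-* (suc k) (k !)) ⟨
    x * (ℕ⇒ℚ (suc k !) * y) ≡⟨ cong (x *_) (*-recip (suc k !) {{ℕ._!≢0 (suc k)}}) ⟩
    x * 1ℚ               ≡⟨ *-identityʳ x ⟩
    x                    ∎
    where
    open ≡-Reasoning
    n = ℕ⇒ℚ (suc k)
    m = ℕ⇒ℚ (k !)
    x = recip! k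
    y = recip! (suc k)

  term-suc : ∀ k p → ℕ⇒ℚ (suc k) * term (suc k) p ≡ p * term k p
  term-suc k p = begin
    n * (p * p ^ k * recip! (suc k))
      ≡⟨ solve 4 (λ n p q y → n :* (p :* q :* y) := p :* (q :* (n :* y))) refl n p (p ^ k) (recip! (suc k)) ⟩
    p * (p ^ k * (n * recip! (suc k)))
      ≡⟨ cong (λ z → p * (p ^ k * z)) (recip!-suc k) ⟩
    p * term k p ∎
    where
    open ≡-Reasoning
    n = ℕ⇒ℚ (suc k)

  ^-nonNeg : ∀ {p} k → 0ℚ ≤ p → 0ℚ ≤ p ^ k
  ^-nonNeg zero    0≤p = <⇒≤ (0<recip 1)
  ^-nonNeg (suc k) 0≤p = 0≤* 0≤p (^-nonNeg k 0≤p)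

  ^-mono-≤ : ∀ {p q} k → 0ℚ ≤ p → p ≤ q → p ^ k ≤ q ^ k
  ^-mono-≤ zero    0≤p p≤q = ≤-refl
  ^-mono-≤ (suc k) 0≤p p≤q = ≤-trans (*-monoˡ-≤ 0≤p (^-mono-≤ k 0≤p p≤q))
    (*-monoʳ-≤ (^-nonNeg k (≤-trans 0≤p p≤q)) p≤q)

  0≤recip! : ∀ k → 0ℚ ≤ recip! k
  0≤recip! k = <⇒≤ (0<recip (k !) {{ℕ._!≢0 k}})

  term-nonNeg : ∀ {p} k → 0ℚ ≤ p → 0ℚ ≤ term k p
  term-nonNeg k 0≤p = 0≤* (^-nonNeg k 0≤p) (0≤recip! k)

  expSum-mono-≤ : ∀ {p q} k → 0ℚ ≤ p → p ≤ q → expSum k p ≤ expSum k q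
  expSum-mono-≤ zero    0≤p p≤q = ≤-refl
  expSum-mono-≤ (suc k) 0≤p p≤q =
    +-mono-≤ (expSum-mono-≤ k 0≤p p≤q) (*-monoʳ-≤ (0≤recip! (suc k)) (^-mono-≤ (suc k) 0≤p p≤q))

  expSum-mono-index : ∀ {p j k} → 0ℚ ≤ p → j ℕ.≤ k → expSum j p ≤ expSum k p
  expSum-mono-index {p} {j} 0≤p j≤k with ℕ.m≤n⇒∃[o]m+o≡n j≤k
  ... | d , refl = go d
    where
    go : ∀ d → expSum j p ≤ expSum (j ℕ.+ d) p
    go zero    = ≤-reflexive (cong (λ k → expSum k p) (sym (ℕ.+-identityʳ j)))
    go (suc d) = ≤-trans (≤-trans (go d) (p≤p+q (term-nonNeg (suc (j ℕ.+ d)) 0≤p)))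
      (≤-reflexive (cong (λ k → expSum k p) (sym (ℕ.+-suc j d))))

  0≤expSum : ∀ {p} k → 0ℚ ≤ p → 0ℚ ≤ expSum k p
  0≤expSum k 0≤p = ≤-trans (<⇒≤ (0<recip 1)) (expSum-mono-index {j = 0} {k} 0≤p ℕ.z≤n)

  expSum-1 : ∀ p → expSum 1 p ≡ 1ℚ + p
  expSum-1 p = cong (1ℚ +_) (trans (*-identityʳ (p * 1ℚ)) (*-identityʳ p))

  term≤expSum : ∀ {p} k → 0ℚ ≤ p → term k p ≤ expSum k p
  term≤expSum zero    0≤p = ≤-reflexive (*-identityʳ 1ℚ)
  term≤expSum (suc k) 0≤p = p≤q+p (0≤expSum k 0≤p)

  ℕ⇒ℚ-suc : ∀ n → ℕ⇒ℚ (suc n) ≡ 1ℚ + ℕ⇒ℚ n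
  ℕ⇒ℚ-suc = ℕ⇒ℚ-+ 1

  module _ (b : ℕ) where

    private
      β = ℕ⇒ℚ b
      0≤β = 0≤ℕ⇒ℚ b
      T = λ k → term k β
      S = λ k → expSum k β

    -- The ratio of consecutive terms is b / (k + 1), at most 1/2 here.
    term-halves : ∀ k → 2 ℕ.* b ℕ.≤ suc k → ℕ⇒ℚ 2 * T (suc k) ≤ T k
    term-halves k 2b≤ = *-cancelˡ-≤ (0<ℕ⇒ℚ (suc k)) (begin
      ℕ⇒ℚ (suc k) * (ℕ⇒ℚ 2 * T (suc k))   ≡⟨ solve 3 (λ x y z → x :* (y :* z) := y :* (x :* z)) refl (ℕ⇒ℚ (suc k)) (ℕ⇒ℚ 2) (T (suc k)) ⟩
      ℕ⇒ℚ 2 * (ℕ⇒ℚ (suc k) * T (suc k))   ≡⟨ cong (ℕ⇒ℚ 2 *_) (term-suc k β) ⟩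
      ℕ⇒ℚ 2 * (β * T k)                   ≡⟨ *-assoc (ℕ⇒ℚ 2) β (T k) ⟨
      ℕ⇒ℚ 2 * β * T k                     ≡⟨ cong (_* T k) (ℕ⇒ℚ-* 2 b) ⟨
      ℕ⇒ℚ (2 ℕ.* b) * T k                 ≤⟨ *-monoʳ-≤ (term-nonNeg k 0≤β) (ℕ⇒ℚ-mono-≤ 2b≤) ⟩
      ℕ⇒ℚ (suc k) * T k                   ∎)
      where open ≤-Reasoning

    -- From index 2b on the terms at least halve, so S + T decreases.

    expSum-bounded : ∀ d → S (2 ℕ.* b ℕ.+ d) + T (2 ℕ.* b ℕ.+ d) ≤ S (2 ℕ.* b) + T (2 ℕ.* b)
    expSum-bounded zero    = ≤-reflexive (cong (λ k → S k + T k) (ℕ.+-identityʳ (2 ℕ.* b)))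
    expSum-bounded (suc d) = begin
      S (K ℕ.+ suc d) + T (K ℕ.+ suc d)   ≡⟨ cong (λ k → S k + T k) (ℕ.+-suc K d) ⟩
      S k + T (suc k) + T (suc k)         ≡⟨ solve 2 (λ x y → x :+ y :+ y := x :+ (con 1ℚ :+ con 1ℚ) :* y) refl (S k) (T (suc k)) ⟩
      S k + ℕ⇒ℚ 2 * T (suc k)             ≤⟨ +-monoʳ-≤ (S k) (term-halves k (ℕ.≤-trans (ℕ.m≤m+n K d) (ℕ.n≤1+n k))) ⟩
      S k + T k                           ≤⟨ expSum-bounded d ⟩
      S K + T K                           ∎
      where
      open ≤-Reasoning
      K = 2 ℕ.* b
      k = K ℕ.+ d

    private
      β⁺ = ℕ⇒ℚ (suc b)
      0≤β⁺ = 0≤ℕ⇒ℚ (suc b)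

    -- (b + 1)ᵏ / k! dominates the first two terms bᵏ / k! + bᵏ⁻¹ / (k - 1)! of
    -- its binomial expansion.

    term-shift : ∀ k → T (suc k) + T k ≤ term (suc k) β⁺
    term-shift zero = ≤-reflexive (begin-equality
      β * 1ℚ * 1ℚ + 1ℚ       ≡⟨ solve 1 (λ β → β :* con 1ℚ :* con 1ℚ :+ con 1ℚ := (con 1ℚ :+ β) :* con 1ℚ :* con 1ℚ) refl β ⟩
      (1ℚ + β) * 1ℚ * 1ℚ     ≡⟨ cong (λ x → x * 1ℚ * 1ℚ) (ℕ⇒ℚ-suc b) ⟨
      β⁺ * 1ℚ * 1ℚ           ∎)
      where open ≤-Reasoning
    term-shift (suc k) = *-cancelˡ-≤ (0<ℕ⇒ℚ (suc (suc k))) (begin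
      n⁺ * (T (suc (suc k)) + T (suc k))
        ≡⟨ *-distribˡ-+ n⁺ (T (suc (suc k))) (T (suc k)) ⟩
      n⁺ * T (suc (suc k)) + n⁺ * T (suc k)
        ≡⟨ cong₂ (λ x y → x + y * T (suc k)) (term-suc (suc k) β) (ℕ⇒ℚ-suc (suc k)) ⟩
      β * T (suc k) + (1ℚ + n) * T (suc k)
        ≡⟨ cong (β * T (suc k) +_) (trans (*-distribʳ-+ (T (suc k)) 1ℚ n) (cong (1ℚ * T (suc k) +_) (term-suc k β))) ⟩
      β * T (suc k) + (1ℚ * T (suc k) + β * T k)
        ≤⟨ p≤p+q (term-nonNeg k 0≤β) ⟩
      β * T (suc k) + (1ℚ * T (suc k) + β * T k) + T k
        ≡⟨ solve 3 (λ β x y → β :* x :+ (con 1ℚ :* x :+ β :* y) :+ y := (con 1ℚ :+ β) :* (x :+ y)) refl β (T (suc k)) (T k) ⟩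
      (1ℚ + β) * (T (suc k) + T k)
        ≡⟨ cong (_* (T (suc k) + T k)) (ℕ⇒ℚ-suc b) ⟨
      β⁺ * (T (suc k) + T k)
        ≤⟨ *-monoˡ-≤ 0≤β⁺ (term-shift k) ⟩
      β⁺ * term (suc k) β⁺
        ≡⟨ term-suc (suc k) β⁺ ⟨
      n⁺ * term (suc (suc k)) β⁺ ∎)
      where
      open ≤-Reasoning
      n = ℕ⇒ℚ (suc k)
      n⁺ = ℕ⇒ℚ (suc (suc k))

    -- `term-shift` added over the indices: a finite form of 2 exp(b) ≤ exp(b + 1).
    expSum-shift : ∀ k → S (suc k) + S k ≤ expSum (suc k) β⁺
    expSum-shift zero = ≤-reflexive (begin-equality
      S 1 + 1ℚ          ≡⟨ cong (_+ 1ℚ) (expSum-1 β) ⟩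
      1ℚ + β + 1ℚ       ≡⟨ solve 1 (λ β → con 1ℚ :+ β :+ con 1ℚ := con 1ℚ :+ (con 1ℚ :+ β)) refl β ⟩
      1ℚ + (1ℚ + β)     ≡⟨ cong (1ℚ +_) (ℕ⇒ℚ-suc b) ⟨
      1ℚ + β⁺           ≡⟨ expSum-1 β⁺ ⟨
      expSum 1 β⁺       ∎)
      where open ≤-Reasoning
    expSum-shift (suc k) = begin
      S (suc k) + T (suc (suc k)) + (S k + T (suc k))
        ≡⟨ solve 4 (λ x y z w → x :+ y :+ (z :+ w) := (x :+ z) :+ (y :+ w)) refl (S (suc k)) (T (suc (suc k))) (S k) (T (suc k)) ⟩
      S (suc k) + S k + (T (suc (suc k)) + T (suc k))
        ≤⟨ +-mono-≤ (expSum-shift k) (term-shift (suc k)) ⟩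
      expSum (suc (suc k)) β⁺ ∎
      where open ≤-Reasoning

    -- The tail after index K = 2b is at most the K-th term, hence at most the K-th partial sum, so
    -- everything is at most S(K + 1) + S(K), to which `expSum-shift` applies. A question about all
    -- partial sums at b is thereby settled by one rational.
    expSum-dominated : ∀ k → expSum k β ≤ expSum (suc (2 ℕ.* b)) β⁺
    expSum-dominated k = begin
      S k                              ≤⟨ expSum-mono-index 0≤β (ℕ.m≤n+m k K) ⟩
      S (K ℕ.+ k)                      ≤⟨ p≤p+q (term-nonNeg (K ℕ.+ k) 0≤β) ⟩
      S (K ℕ.+ k) + T (K ℕ.+ k)        ≤⟨ expSum-bounded k ⟩
      S K + T K                        ≤⟨ +-mono-≤ (expSum-mono-index 0≤β (ℕ.n≤1+n K)) (term≤expSum K 0≤β) ⟩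
      S (suc K) + S K                  ≤⟨ expSum-shift K ⟩
      expSum (suc K) β⁺                ∎
      where
      open ≤-Reasoning
      K = 2 ℕ.* b

-- Sums over unordered pairs, and the Turán colouring.

module PairSums where

  open Counting
  open import Data.Bool.Base using (Bool; true; false; not; if_then_else_)
  open import Data.Fin.Base using (Fin; zero; suc)
  import Data.Fin.Base as Fin
  import Data.Fin.Properties as Fin
  open import Data.List.Base using (List; []; _∷_; _++_; allFin; cartesianProduct; filter; length; map; tabulate)
  open import Data.List.Properties using (map-++; map-∘; map-tabulate)
  open import Data.Nat.Base
  open import Data.Nat.Combinatorics using (_C_; nC1≡n; nCk+nC[k+1]≡[n+1]C[k+1])
  import Data.Nat.ListAction as List
  open import Data.Nat.ListAction.Properties using (sum-++)
  open import Data.Nat.Properties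
  open import Data.Nat.Tactic.RingSolver using (solve-∀)
  open import Data.Product.Base using (∃-syntax; _×_; _,_; uncurry)
  open import Defs using (K; edges; adj?)
  open ErdosStone using (total; deg; total-remove)
  open import Function.Base using (_∘_; id)
  open import Relation.Binary.PropositionalEquality
  open import Relation.Nullary using (does)
  open import Relation.Nullary.Decidable using (_×-dec_)
  open import Relation.Unary using (Decidable)

  # : {A : Set} → (A → Bool) → List A → ℕ
  # B L = List.sum (map (⟦_⟧ ∘ B) L)

  #-complement : ∀ {A : Set} (B : A → Bool) L → # B L + # (not ∘ B) L ≡ length L
  #-complement B []      = refl
  #-complement B (x ∷ L) with B x
  ... | true  = cong suc (#-complement B L)
  ... | false = trans (+-suc (# B L) _) (cong suc (#-complement B L))

  sum-filter : ∀ {A : Set} {P : A → Set} (P? : Decidable P) (h : A → ℕ) L →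
    List.sum (map h (filter P? L)) ≡ List.sum (map (λ x → if does (P? x) then h x else 0) L)
  sum-filter P? h []      = refl
  sum-filter P? h (x ∷ L) with does (P? x)
  ... | true  = cong (h x +_) (sum-filter P? h L)
  ... | false = sum-filter P? h L

  sum-cartesianProduct : ∀ {A B : Set} (g : A × B → ℕ) xs ys →
    List.sum (map g (cartesianProduct xs ys)) ≡ List.sum (map (λ x → List.sum (map (λ y → g (x , y)) ys)) xs)
  sum-cartesianProduct g []       ys = refl
  sum-cartesianProduct g (x ∷ xs) ys = begin
    List.sum (map g (map (x ,_) ys ++ cartesianProduct xs ys))
      ≡⟨ cong List.sum (map-++ g (map (x ,_) ys) (cartesianProduct xs ys)) ⟩
    List.sum (map g (map (x ,_) ys) ++ map g (cartesianProduct xs ys))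
      ≡⟨ sum-++ (map g (map (x ,_) ys)) _ ⟩
    List.sum (map g (map (x ,_) ys)) + List.sum (map g (cartesianProduct xs ys))
      ≡⟨ cong₂ _+_ (cong List.sum (sym (map-∘ ys))) (sum-cartesianProduct g xs ys) ⟩
    _ ∎
    where open ≡-Reasoning

  sum-allFin : ∀ {n} (f : Fin n → ℕ) → List.sum (map f (allFin n)) ≡ sum f
  sum-allFin f = trans (cong List.sum (map-tabulate id f)) (go f)
    where
    go : ∀ {n} (f : Fin n → ℕ) → List.sum (tabulate f) ≡ sum f
    go {zero}  f = refl
    go {suc n} f = cong (f zero +_) (go (f ∘ suc))

  pairSum : ∀ n → (Fin n → Fin n → ℕ) → ℕ
  pairSum n h = List.sum (map (uncurry h) (edges (K n)))

  pairSum-∑ : ∀ n h → pairSum n h ≡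
    ∑[ u < n ] ∑[ v < n ] (if does ((u Fin.<? v) ×-dec adj? (K n) u v) then h u v else 0)
  pairSum-∑ n h = begin
    pairSum n h
      ≡⟨ sum-filter (λ (u , v) → (u Fin.<? v) ×-dec adj? (K n) u v) (uncurry h) (cartesianProduct (allFin n) (allFin n)) ⟩
    _ ≡⟨ sum-cartesianProduct _ (allFin n) (allFin n) ⟩
    _ ≡⟨ sum-allFin {n} _ ⟩
    _ ≡⟨ sum-cong-≗ {n} (λ u → sum-allFin {n} _) ⟩
    _ ∎
    where open ≡-Reasoning

  -- The tests `u < v` and `u ≢ v` evaluate on `zero` and `suc`, so after `pairSum-∑` the pairs
  -- containing `zero` split off by computation.
  pairSum-suc : ∀ n h → pairSum (suc n) h ≡ ∑[ v < n ] h zero (suc v) + pairSum n (λ u v → h (suc u) (suc v))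
  pairSum-suc n h = trans (pairSum-∑ (suc n) h)
    (cong (∑[ v < n ] h zero (suc v) +_) (sym (pairSum-∑ n λ u v → h (suc u) (suc v))))

  length-edges-K : ∀ n → length (edges (K n)) ≡ n C 2
  length-edges-K n = trans (sym (go (edges (K n)))) (pairs n)
    where
    go : ∀ {A : Set} (L : List A) → List.sum (map (λ _ → 1) L) ≡ length L
    go []      = refl
    go (_ ∷ L) = cong suc (go L)
    pairs : ∀ n → pairSum n (λ _ _ → 1) ≡ n C 2
    pairs zero    = refl
    pairs (suc n) = begin
      pairSum (suc n) (λ _ _ → 1)               ≡⟨ pairSum-suc n (λ _ _ → 1) ⟩
      sum {n} (λ _ → 1) + pairSum n (λ _ _ → 1) ≡⟨ cong₂ _+_ (trans (sum-const n 1) (*-identityʳ n)) (pairs n) ⟩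
      n + n C 2                                 ≡⟨ cong (_+ n C 2) (nC1≡n n) ⟨
      n C 1 + n C 2                             ≡⟨ nCk+nC[k+1]≡[n+1]C[k+1] n 1 ⟩
      suc n C 2                                 ∎
      where open ≡-Reasoning

  nC2-suc : ∀ n → suc n C 2 ≡ n + n C 2
  nC2-suc n = trans (sym (nCk+nC[k+1]≡[n+1]C[k+1] n 1)) (cong (_+ n C 2) (nC1≡n n))

  2*nC2 : ∀ n → 2 * (suc n C 2) ≡ suc n * n
  2*nC2 zero    = refl
  2*nC2 (suc n) = begin
    2 * (suc (suc n) C 2)             ≡⟨ cong (2 *_) (nC2-suc (suc n)) ⟩
    2 * (suc n + suc n C 2)           ≡⟨ *-distribˡ-+ 2 (suc n) (suc n C 2) ⟩
    2 * suc n + 2 * (suc n C 2)       ≡⟨ cong (2 * suc n +_) (2*nC2 n) ⟩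
    2 * suc n + suc n * n             ≡⟨ arith n ⟩
    suc (suc n) * suc n               ∎
    where
    open ≡-Reasoning
    arith : ∀ n → 2 * suc n + suc n * n ≡ suc (suc n) * suc n
    arith = solve-∀

  -- Each pair is counted from both ends; the induction removes vertex `zero` from both sides.
  total-pairSum : ∀ {n} (a : Fin n → Fin n → Bool) → (∀ u v → a u v ≡ a v u) → (∀ u → a u u ≡ false) →
    total a ≡ 2 * pairSum n (λ u v → ⟦ a u v ⟧)
  total-pairSum {zero}  a sym-a irr-a = refl
  total-pairSum {suc n} a sym-a irr-a = begin
    total a
      ≡⟨ total-remove a sym-a zero (irr-a zero) ⟩
    total a′ + 2 * deg a zero
      ≡⟨ cong₂ (λ x b → x + 2 * (⟦ b ⟧ + row)) (total-pairSum a′ (λ u v → sym-a _ _) (λ u → irr-a _)) (irr-a zero) ⟩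
    2 * pairs′ + 2 * row
      ≡⟨ arith pairs′ row ⟩
    2 * (row + pairs′)
      ≡⟨ cong (2 *_) (pairSum-suc n λ u v → ⟦ a u v ⟧) ⟨
    2 * pairSum (suc n) (λ u v → ⟦ a u v ⟧) ∎
    where
    open ≡-Reasoning
    a′ : Fin n → Fin n → Bool
    a′ u v = a (suc u) (suc v)
    row = ∑[ v < n ] ⟦ a zero (suc v) ⟧
    pairs′ = pairSum n (λ u v → ⟦ a′ u v ⟧)
    arith : ∀ x y → 2 * x + 2 * y ≡ 2 * (y + x)
    arith = solve-∀

  -- The colour classes of the Turán graph: each new vertex gets a colour that
  -- is used least often so far.

  equitable-colouring : ∀ r n → ∃[ c ] suc r * pairSum n (λ u v → ⟦ does (c v Fin.≟ c u) ⟧) ≤ n C 2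
  equitable-colouring r zero    = (λ ()) , ≤-reflexive (*-zeroʳ r)
  equitable-colouring r (suc n) with equitable-colouring r n
  ... | c , bound with some-below-average {r} (λ i → count λ v → does (c v Fin.≟ i))
  ...   | i , least = c⁺ , (begin
    suc r * pairSum (suc n) (mono c⁺)
      ≡⟨ cong (suc r *_) (pairSum-suc n (mono c⁺)) ⟩
    suc r * (∑[ v < n ] ⟦ does (c v Fin.≟ i) ⟧ + pairSum n (mono c))
      ≡⟨ *-distribˡ-+ (suc r) (∑[ v < n ] ⟦ does (c v Fin.≟ i) ⟧) (pairSum n (mono c)) ⟩
    suc r * (∑[ v < n ] ⟦ does (c v Fin.≟ i) ⟧) + suc r * pairSum n (mono c)
      ≤⟨ +-mono-≤ (≤-trans least (≤-reflexive (sum-fibres {m = suc r} (λ _ → true) c))) bound ⟩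
    count {n} (λ _ → true) + n C 2
      ≡⟨ cong (_+ n C 2) (trans (sum-const n 1) (*-identityʳ n)) ⟩
    n + n C 2
      ≡⟨ nC2-suc n ⟨
    suc n C 2 ∎)
    where
    open ≤-Reasoning
    mono : ∀ {n} → (Fin n → Fin (suc r)) → Fin n → Fin n → ℕ
    mono c u v = ⟦ does (c v Fin.≟ c u) ⟧
    c⁺ : Fin (suc n) → Fin (suc r)
    c⁺ zero    = i
    c⁺ (suc v) = c v

-- Logarithms and weighted sums as upper cuts.

module Cuts where

  open Counting using (⟦_⟧)
  open PairSums using (#)
  open import Data.Bool.Base using (Bool; true; false; not; if_then_else_)
  open import Data.List.Base using (List; []; _∷_; map)
  open import Data.List.Membership.Propositional using (_∈_)
  open import Data.List.Relation.Unary.Any using (here; there)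
  open import Data.Nat.Base as ℕ using (ℕ; zero; suc)
  import Data.Nat.Properties as ℕ
  open import Data.Product.Base using (∃-syntax; _×_; _,_)
  open import Data.Rational.Base as ℚ using (ℚ; 0ℚ; 1ℚ)
  import Data.Rational.Properties as ℚ
  open import Data.Rational.Solver using (module +-*-Solver)
  open import Data.Sum.Base using (inj₁; inj₂)
  open import Defs
  open Exponential
  open import Function.Base using (_∘_)
  open Rationals
  open import Relation.Binary.PropositionalEquality
  open import Relation.Nullary using (Dec; yes; no)

  open +-*-Solver using (solve; _:+_; _:*_; _:-_; _:=_; con)

  <ℚ-≤ : ∀ x {p q} → x <ℚ p → p ℚ.≤ q → x <ℚ q
  <ℚ-≤ x x<p p≤q = let r , r<p , x<r = ℝ.rounded x x<p in ℝ.upward x x<r (ℚ.<-≤-trans r<p p≤q)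

  fromℚ< : ∀ {p q} → fromℚ p <ℚ q → p ℚ.< q
  fromℚ< (_ , refl , p<q) = p<q

  fromℚ-cancel-≤ : ∀ {p q} → fromℚ p ≤ fromℚ q → p ℚ.≤ q
  fromℚ-cancel-≤ {p} {q} p≤q = ℚ.≮⇒≥ λ q<p → ℚ.<-irrefl refl (fromℚ< (p≤q p (q , refl , q<p)))

  ≤-trans : ∀ x y z → x ≤ y → y ≤ z → x ≤ z
  ≤-trans _ _ _ x≤y y≤z q = x≤y q ∘ y≤z q

  <ℚ⇒≤fromℚ : ∀ x {p} → x <ℚ p → x ≤ fromℚ p
  <ℚ⇒≤fromℚ x x<p q p<q = ℝ.upward x x<p (fromℚ< p<q)

  log-mono-≤ : ∀ m n → m ℕ.≤ n → log m ≤ log n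
  log-mono-≤ m n m≤n q (p , (0≤p , k , n≤) , p<q) = p , (0≤p , k , ℚ.≤-trans (ℕ⇒ℚ-mono-≤ m≤n) n≤) , p<q

  log-upper : ∀ n {p} k → 0ℚ ℚ.≤ p → ℕ⇒ℚ n ℚ.≤ expSum k p → log n ≤ fromℚ p
  log-upper n k 0≤p n≤ q p<q = _ , (0≤p , k , n≤) , fromℚ< p<q

  -- Partial sums that stay below n at b do so at every smaller p ≥ 0, so whatever reaches n lies
  -- above b.
  log-lower : ∀ n {b} → (∀ k → expSum k b ℚ.< ℕ⇒ℚ n) → fromℚ b ≤ log n
  log-lower n <n q (p , (0≤p , k , n≤) , p<q) = _ , refl ,
    ℚ.<-trans (ℚ.≰⇒> λ p≤b → ℚ.<-irrefl refl (ℚ.≤-<-trans (ℚ.≤-trans n≤ (expSum-mono-≤ k 0≤p p≤b)) (<n k))) p<q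

  0≤log : ∀ n → fromℚ 0ℚ ≤ log n
  0≤log n q (p , (0≤p , _) , p<q) = _ , refl , ℚ.≤-<-trans 0≤p p<q

  ℕ⇒ℚ≤expSum : ∀ n → ℕ⇒ℚ n ℚ.≤ expSum 1 (ℕ⇒ℚ n)
  ℕ⇒ℚ≤expSum n = ℚ.≤-trans (p≤q+p (ℚ.<⇒≤ (0<recip 1))) (ℚ.≤-reflexive (sym (expSum-1 (ℕ⇒ℚ n))))

  -- Two terms of the series give exp n ≥ 1 + n. The bound is crude, but it supplies a rational
  -- above the cut.
  log<suc : ∀ n → log n <ℚ ℕ⇒ℚ (suc n)
  log<suc n = ℕ⇒ℚ n , (0≤ℕ⇒ℚ n , 1 , ℕ⇒ℚ≤expSum n) , ℕ⇒ℚ-mono-< (ℕ.n<1+n n)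

  log-unbounded : ∀ N → ∃[ L ] ∀ ℓ → L ℕ.≤ ℓ → fromℚ (ℕ⇒ℚ N) ≤ log ℓ
  log-unbounded N with archimedean (expSum (suc (2 ℕ.* N)) (ℕ⇒ℚ (suc N)))
  ... | L , S≤L = suc L , λ ℓ L<ℓ → log-lower ℓ λ k →
    ℚ.≤-<-trans (ℚ.≤-trans (expSum-dominated N k) S≤L) (ℕ⇒ℚ-mono-< L<ℓ)

  -- Whether log ℓ exceeds b involves infinitely many partial sums, but `Reaches b` compares two
  -- rationals. If it fails at b, `expSum-dominated` gives b ≤ log ℓ; if it holds at b + 1, then log
  -- ℓ ≤ b + 2. The search descends from b = ℓ, where it holds.
  log-locate : ∀ ℓ → ∃[ i ] fromℚ (ℕ⇒ℚ i) ≤ log ℓ × log ℓ ≤ fromℚ (ℕ⇒ℚ (2 ℕ.+ i))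
  log-locate ℓ = search ℓ (ℚ.≤-trans (ℕ⇒ℚ≤expSum ℓ) (expSum-dominated ℓ 1))
    where
    Reaches : ℕ → Set
    Reaches b = ℕ⇒ℚ ℓ ℚ.≤ expSum (suc (2 ℕ.* b)) (ℕ⇒ℚ (suc b))

    Located : Set
    Located = ∃[ i ] fromℚ (ℕ⇒ℚ i) ≤ log ℓ × log ℓ ≤ fromℚ (ℕ⇒ℚ (2 ℕ.+ i))

    search : ∀ b → Reaches b → Located
    step : ∀ b → Reaches (suc b) → Dec (Reaches b) → Located

    search zero    ℓ≤ = 0 , 0≤log ℓ , log-upper ℓ 1 (0≤ℕ⇒ℚ 2)
      (ℚ.≤-trans ℓ≤ (expSum-mono-≤ 1 (0≤ℕ⇒ℚ 1) (ℕ⇒ℚ-mono-≤ {1} {2} (ℕ.s≤s ℕ.z≤n))))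
    search (suc b) ℓ≤ = step b ℓ≤ (_ ℚ.≤? _)

    step b ℓ≤ (yes ℓ≤′) = search b ℓ≤′
    step b ℓ≤ (no  ℓ≰)  = b , log-lower ℓ (λ k → ℚ.≤-<-trans (expSum-dominated b k) (ℚ.≰⇒> ℓ≰)) ,
                          log-upper ℓ (suc (2 ℕ.* suc b)) (0≤ℕ⇒ℚ (2 ℕ.+ b)) ℓ≤

  -- Two points m < n of the gap suffice: m - q exceeds p, and n - (m - q) exceeds q because n > m.
  split-< : ∀ p q {r} → p ℚ.+ q ℚ.< r → ∃[ p′ ] ∃[ q′ ] p ℚ.< p′ × q ℚ.< q′ × p′ ℚ.+ q′ ℚ.< r
  split-< p q p+q<r =
    let m , p+q<m , m<r = ℚ.<-dense p+q<r
        n , m<n , n<r   = ℚ.<-dense m<r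
    in m ℚ.- q , n ℚ.- (m ℚ.- q) ,
       subst (ℚ._< m ℚ.- q) (solve 2 (λ p q → p :+ q :- q := p) refl p q) (ℚ.+-monoˡ-< (ℚ.- q) p+q<m) ,
       subst (ℚ._< n ℚ.- (m ℚ.- q)) (solve 2 (λ m q → m :- (m :- q) := q) refl m q) (ℚ.+-monoˡ-< (ℚ.- (m ℚ.- q)) m<n) ,
       subst (ℚ._< _) (solve 2 (λ x n → n := x :+ (n :- x)) refl (m ℚ.- q) n) n<r

  +-intro : ∀ x y {p q r} → x ≤ fromℚ p → y ≤ fromℚ q → p ℚ.+ q ℚ.< r → x + y <ℚ r
  +-intro x y {p} {q} x≤p y≤q p+q<r = let p′ , q′ , p<p′ , q<q′ , lt = split-< p q p+q<r in
    p′ ℚ.+ q′ , (p′ , q′ , x≤p p′ (p , refl , p<p′) , y≤q q′ (q , refl , q<q′) , refl) , lt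

  mix-intro : ∀ r s x y {a c q} → x <ℚ a → y <ℚ c → r ℚ.* a ℚ.+ s ℚ.* c ℚ.< q → r · x + s · y <ℚ q
  mix-intro r s x y x<a y<c = +-intro (r · x) (s · y)
    (λ q ra<q → _ , (_ , x<a , refl) , fromℚ< ra<q) (λ q sc<q → _ , (_ , y<c , refl) , fromℚ< sc<q)

  mix-elim : ∀ r s x y {q} → r · x + s · y <ℚ q → ∃[ a ] ∃[ c ] x <ℚ a × y <ℚ c × r ℚ.* a ℚ.+ s ℚ.* c ℚ.< q
  mix-elim r s x y (_ , (_ , _ , (_ , (a , x<a , refl) , ra<) , (_ , (c , y<c , refl) , sc<) , refl) , p<q) =
    a , c , x<a , y<c , ℚ.<-trans (ℚ.+-mono-< ra< sc<) p<q

  -- With the total weight fixed, m a + m′ c = (m + m′) c + m (a - c) grows with m because a - c ≥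
  -- 0.
  mix-mono : ∀ {m m′ n n′ a c} → c ℚ.≤ a → m ℚ.≤ n → m ℚ.+ m′ ≡ n ℚ.+ n′ →
    m ℚ.* a ℚ.+ m′ ℚ.* c ℚ.≤ n ℚ.* a ℚ.+ n′ ℚ.* c
  mix-mono {m} {m′} {n} {n′} {a} {c} c≤a m≤n eq = begin
    m ℚ.* a ℚ.+ m′ ℚ.* c                    ≡⟨ regroup m m′ ⟩
    (m ℚ.+ m′) ℚ.* c ℚ.+ m ℚ.* (a ℚ.- c)    ≤⟨ ℚ.+-mono-≤ (ℚ.≤-reflexive (cong (ℚ._* c) eq)) (*-monoʳ-≤ 0≤a-c m≤n) ⟩
    (n ℚ.+ n′) ℚ.* c ℚ.+ n ℚ.* (a ℚ.- c)    ≡⟨ regroup n n′ ⟨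
    n ℚ.* a ℚ.+ n′ ℚ.* c                    ∎
    where
    open ℚ.≤-Reasoning
    regroup : ∀ m m′ → m ℚ.* a ℚ.+ m′ ℚ.* c ≡ (m ℚ.+ m′) ℚ.* c ℚ.+ m ℚ.* (a ℚ.- c)
    regroup m m′ = solve 4 (λ m m′ a c → m :* a :+ m′ :* c := (m :+ m′) :* c :+ m :* (a :- c)) refl m m′ a c
    0≤a-c : 0ℚ ℚ.≤ a ℚ.- c
    0≤a-c = subst (ℚ._≤ a ℚ.- c) (ℚ.+-inverseʳ c) (ℚ.+-monoˡ-≤ (ℚ.- c) c≤a)

  ⊓-<ℚ : ∀ x {p q} → x <ℚ p → x <ℚ q → x <ℚ p ℚ.⊓ q
  ⊓-<ℚ x {p} {q} x<p x<q with ℚ.⊓-sel p q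
  ... | inj₁ eq = subst (x <ℚ_) (sym eq) x<p
  ... | inj₂ eq = subst (x <ℚ_) (sym eq) x<q

  private
    [1+m]a+nc : ∀ m n a c → ℕ⇒ℚ (suc m) ℚ.* a ℚ.+ n ℚ.* c ≡ a ℚ.+ (ℕ⇒ℚ m ℚ.* a ℚ.+ n ℚ.* c)
    [1+m]a+nc m n a c = trans (cong (λ x → x ℚ.* a ℚ.+ n ℚ.* c) (ℕ⇒ℚ-suc m))
      (solve 4 (λ x y a c → (con 1ℚ :+ x) :* a :+ y :* c := a :+ (x :* a :+ y :* c)) refl (ℕ⇒ℚ m) n a c)

    ma+[1+n]c : ∀ m n a c → m ℚ.* a ℚ.+ ℕ⇒ℚ (suc n) ℚ.* c ≡ c ℚ.+ (m ℚ.* a ℚ.+ ℕ⇒ℚ n ℚ.* c)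
    ma+[1+n]c m n a c = trans (cong (λ y → m ℚ.* a ℚ.+ y ℚ.* c) (ℕ⇒ℚ-suc n))
      (solve 4 (λ x y a c → x :* a :+ (con 1ℚ :+ y) :* c := c :+ (x :* a :+ y :* c)) refl m (ℕ⇒ℚ n) a c)

    upper-step : ∀ x y b m n {a c} → x ≤ fromℚ (if b then a else c) → y ≤ fromℚ (ℕ⇒ℚ m ℚ.* a ℚ.+ ℕ⇒ℚ n ℚ.* c) →
      x + y ≤ fromℚ (ℕ⇒ℚ (⟦ b ⟧ ℕ.+ m) ℚ.* a ℚ.+ ℕ⇒ℚ (⟦ not b ⟧ ℕ.+ n) ℚ.* c)
    upper-step x y true  m n {a} {c} x≤ y≤ q lt = +-intro x y x≤ y≤ (subst (ℚ._< q) ([1+m]a+nc m (ℕ⇒ℚ n) a c) (fromℚ< lt))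
    upper-step x y false m n {a} {c} x≤ y≤ q lt = +-intro x y x≤ y≤ (subst (ℚ._< q) (ma+[1+n]c (ℕ⇒ℚ m) n a c) (fromℚ< lt))

    -- The entries of a sum come with different rational bounds, whereas a common a and c are
    -- wanted. Replacing a or c by its minimum with the new bound only lowers the terms already
    -- counted.
    lower-step : ∀ x y b m n {a c p q} → x <ℚ a → y <ℚ c → (b ≡ true → x <ℚ p) → (b ≡ false → y <ℚ p) →
      ℕ⇒ℚ m ℚ.* a ℚ.+ ℕ⇒ℚ n ℚ.* c ℚ.≤ q →
      ∃[ a′ ] ∃[ c′ ] x <ℚ a′ × y <ℚ c′ × ℕ⇒ℚ (⟦ b ⟧ ℕ.+ m) ℚ.* a′ ℚ.+ ℕ⇒ℚ (⟦ not b ⟧ ℕ.+ n) ℚ.* c′ ℚ.≤ p ℚ.+ q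
    lower-step x y true m n {a} {c} {p} {q} x<a y<c x<p _ ≤q = a ℚ.⊓ p , c , ⊓-<ℚ x x<a (x<p refl) , y<c , (begin
      ℕ⇒ℚ (suc m) ℚ.* (a ℚ.⊓ p) ℚ.+ ℕ⇒ℚ n ℚ.* c
        ≡⟨ [1+m]a+nc m (ℕ⇒ℚ n) (a ℚ.⊓ p) c ⟩
      a ℚ.⊓ p ℚ.+ (ℕ⇒ℚ m ℚ.* (a ℚ.⊓ p) ℚ.+ ℕ⇒ℚ n ℚ.* c)
        ≤⟨ ℚ.+-mono-≤ (ℚ.p⊓q≤q a p) (ℚ.+-monoˡ-≤ (ℕ⇒ℚ n ℚ.* c) (*-monoˡ-≤ (0≤ℕ⇒ℚ m) (ℚ.p⊓q≤p a p))) ⟩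
      p ℚ.+ (ℕ⇒ℚ m ℚ.* a ℚ.+ ℕ⇒ℚ n ℚ.* c)
        ≤⟨ ℚ.+-monoʳ-≤ p ≤q ⟩
      p ℚ.+ q ∎)
      where open ℚ.≤-Reasoning
    lower-step x y false m n {a} {c} {p} {q} x<a y<c _ y<p ≤q = a , c ℚ.⊓ p , x<a , ⊓-<ℚ y y<c (y<p refl) , (begin
      ℕ⇒ℚ m ℚ.* a ℚ.+ ℕ⇒ℚ (suc n) ℚ.* (c ℚ.⊓ p)
        ≡⟨ ma+[1+n]c (ℕ⇒ℚ m) n a (c ℚ.⊓ p) ⟩
      c ℚ.⊓ p ℚ.+ (ℕ⇒ℚ m ℚ.* a ℚ.+ ℕ⇒ℚ n ℚ.* (c ℚ.⊓ p))
        ≤⟨ ℚ.+-mono-≤ (ℚ.p⊓q≤q c p) (ℚ.+-monoʳ-≤ (ℕ⇒ℚ m ℚ.* a) (*-monoˡ-≤ (0≤ℕ⇒ℚ n) (ℚ.p⊓q≤p c p))) ⟩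
      p ℚ.+ (ℕ⇒ℚ m ℚ.* a ℚ.+ ℕ⇒ℚ n ℚ.* c)
        ≤⟨ ℚ.+-monoʳ-≤ p ≤q ⟩
      p ℚ.+ q ∎)
      where open ℚ.≤-Reasoning

  module _ {A : Set} (f : A → ℝ) (B : A → Bool) where

    private
      #B #¬B : List A → ℕ
      #B  = # B
      #¬B = # (not ∘ B)

    Σℝ-upper : ∀ {a c} L → (∀ {i} → i ∈ L → f i ≤ fromℚ (if B i then a else c)) →
      Σℝ (map f L) ≤ fromℚ (ℕ⇒ℚ (#B L) ℚ.* a ℚ.+ ℕ⇒ℚ (#¬B L) ℚ.* c)
    Σℝ-upper {a} {c} [] f≤ q (_ , refl , lt) = 0ℚ , refl ,
      subst (ℚ._< q) (solve 2 (λ a c → con 0ℚ :* a :+ con 0ℚ :* c := con 0ℚ) refl a c) lt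
    Σℝ-upper (i ∷ L) f≤ = upper-step (f i) (Σℝ (map f L)) (B i) (#B L) (#¬B L) (f≤ (here refl)) (Σℝ-upper L (f≤ ∘ there))

    -- A rational p above the sum splits into bounds for the entries, whose minima over the two
    -- classes serve as a and c. `a₀` and `c₀` start these minima, so that an empty class has a
    -- value too.
    Σℝ-lower : ∀ x y {a₀ c₀} → x <ℚ a₀ → y <ℚ c₀ → (∀ i → B i ≡ true → x ≤ f i) → (∀ i → B i ≡ false → y ≤ f i) →
      ∀ L {p} → Σℝ (map f L) <ℚ p →
      ∃[ a ] ∃[ c ] x <ℚ a × y <ℚ c × ℕ⇒ℚ (#B L) ℚ.* a ℚ.+ ℕ⇒ℚ (#¬B L) ℚ.* c ℚ.≤ p
    Σℝ-lower x y {a₀} {c₀} x< y< x≤ y≤ [] (_ , refl , 0<p) = a₀ , c₀ , x< , y< ,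
      subst (ℚ._≤ _) (solve 2 (λ a c → con 0ℚ := con 0ℚ :* a :+ con 0ℚ :* c) refl a₀ c₀) (ℚ.<⇒≤ 0<p)
    Σℝ-lower x y x< y< x≤ y≤ (i ∷ L) (_ , (p₁ , p₂ , fi<p₁ , Σ<p₂ , refl) , p₁+p₂<p) =
      let a  , c  , x<a  , y<c  , ≤p₂ = Σℝ-lower x y x< y< x≤ y≤ L Σ<p₂
          a′ , c′ , x<a′ , y<c′ , ≤p  = lower-step x y (B i) (#B L) (#¬B L) x<a y<c
            (λ eq → x≤ i eq p₁ fi<p₁) (λ eq → y≤ i eq p₁ fi<p₁) ≤p₂
      in a′ , c′ , x<a′ , y<c′ , ℚ.≤-trans ≤p (ℚ.<⇒≤ p₁+p₂<p)

-- Subsets and systems of distinct representatives.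

module Representatives where

  open Counting
  open import Data.Bool.Base using (Bool; true; false)
  open import Data.Fin.Base using (Fin; zero; suc; toℕ; fromℕ<; punchIn; punchOut)
  import Data.Fin.Properties as Fin
  open import Data.Fin.Subset
  open import Data.Fin.Subset.Properties
  open import Data.Nat.Base
  open import Data.Nat.Properties
  open import Data.Product.Base using (∃-syntax; Σ-syntax; _×_; _,_)
  open import Data.Vec.Base using ([]; _∷_; tabulate)
  open import Data.Vec.Properties using (lookup∘tabulate; lookup⇒[]=; []=⇒lookup)
  open import Defs using (HasSDR)
  open import Function.Base using (_∘_)
  open import Function.Definitions using (Injective)
  open import Relation.Binary.PropositionalEquality
  open import Relation.Nullary using (Dec; does; yes; no; contradiction)
  open import Relation.Nullary.Decidable using (_×-dec_; ¬?; decidable-stable)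

  ∣tabulate∣ : ∀ {n} (p : Fin n → Bool) → ∣ tabulate p ∣ ≡ count p
  ∣tabulate∣ {zero}  p = refl
  ∣tabulate∣ {suc n} p with p zero
  ... | true  = cong suc (∣tabulate∣ (p ∘ suc))
  ... | false = ∣tabulate∣ (p ∘ suc)

  ∈-tabulate⁺ : ∀ {n} {p : Fin n → Bool} {x} → p x ≡ true → x ∈ tabulate p
  ∈-tabulate⁺ {p = p} {x} px = lookup⇒[]= x (tabulate p) (trans (lookup∘tabulate p x) px)

  ∈-tabulate⁻ : ∀ {n} {p : Fin n → Bool} {x} → x ∈ tabulate p → p x ≡ true
  ∈-tabulate⁻ {p = p} {x} x∈ = trans (sym (lookup∘tabulate p x)) ([]=⇒lookup x∈)

  0<∣p∣⇒Nonempty : ∀ {n} (p : Subset n) → 0 < ∣ p ∣ → Nonempty p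
  0<∣p∣⇒Nonempty {n} p 0<p = decidable-stable (nonempty? p) λ empty →
    <-irrefl (sym (trans (cong ∣_∣ (Empty-unique empty)) (∣⊥∣≡0 n))) 0<p

  Nonempty⇒0<∣p∣ : ∀ {n} {p : Subset n} {x} → x ∈ p → 0 < ∣ p ∣
  Nonempty⇒0<∣p∣ x∈p = m<n⇒0<n (x∈p⇒∣p-x∣<∣p∣ x∈p)

  singleton : ∀ {n} (p : Subset n) → ∣ p ∣ ≡ 1 → ∃[ x ] x ∈ p × (∀ y → y ∈ p → y ≡ x)
  singleton p ∣p∣≡1 with 0<∣p∣⇒Nonempty p (≤-reflexive (sym ∣p∣≡1))
  ... | x , x∈p = x , x∈p , λ y y∈p → decidable-stable (y Fin.≟ x) λ y≢x →
    <⇒≱ (x∈p⇒∣p-x∣<∣p∣ x∈p) (≤-trans (≤-reflexive ∣p∣≡1) (Nonempty⇒0<∣p∣ (x∈p∧x≢y⇒x∈p-y y∈p y≢x)))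

  enlarge : ∀ {n} (p : Subset n) {j} → ∣ p ∣ ≤ j → j ≤ n → ∃[ q ] p ⊆ q × ∣ q ∣ ≡ j
  enlarge []            {zero}  _       _       = [] , ⊆-refl , refl
  enlarge (inside ∷ p)  {suc j} (s≤s ≤j) (s≤s j≤) =
    let q , p⊆q , ∣q∣≡j = enlarge p ≤j j≤ in inside ∷ q , in⊆in p⊆q , cong suc ∣q∣≡j
  enlarge {suc n} (outside ∷ p) {j} ≤j j≤ with j ≤? n
  ... | yes j≤n = let q , p⊆q , ∣q∣≡j = enlarge p ≤j j≤n in outside ∷ q , out⊆ p⊆q , ∣q∣≡j
  ... | no  j≰n = ⊤ , ⊆⊤ , trans (∣⊤∣≡n (suc n)) (≤-antisym (≰⇒> j≰n) j≤)

  firstℕ : ∀ {n} → ℕ → Fin n → Bool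
  firstℕ j x = does (toℕ x <? j)

  count-firstℕ : ∀ {n j} → j ≤ n → count {n} (firstℕ j) ≡ j
  count-firstℕ {n}     {zero}  _        = sum-zero n
  count-firstℕ {suc n} {suc j} (s≤s j≤) = cong suc (count-firstℕ {n} {j} j≤)

  first : ∀ {n} → ℕ → Subset n
  first j = tabulate (firstℕ j)

  ∣first∣ : ∀ {n j} → j ≤ n → ∣ first {n} j ∣ ≡ j
  ∣first∣ {n} {j} j≤n = trans (∣tabulate∣ (firstℕ {n} j)) (count-firstℕ {n} j≤n)

  ∈-first⁻ : ∀ {n j} {x : Fin n} → x ∈ first j → toℕ x < j
  ∈-first⁻ {j = j} {x} x∈ = does⇒ (toℕ x <? j) (∈-tabulate⁻ {p = firstℕ j} x∈)

  first-injective⇒≤ : ∀ {m n j} {f : Fin m → Fin n} → Injective _≡_ _≡_ f → (∀ i → f i ∈ first j) → m ≤ j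
  first-injective⇒≤ {j = j} {f} f-inj f∈ = Fin.injective⇒≤ {f = λ i → fromℕ< (∈-first⁻ (f∈ i))}
    λ {x} {y} eq → f-inj (Fin.toℕ-injective (Fin.fromℕ<-injective _ _ (∈-first⁻ (f∈ x)) (∈-first⁻ (f∈ y)) eq))

  ∣p∪q∣≤∣p∣+∣q∣ : ∀ {n} (p q : Subset n) → ∣ p ∪ q ∣ ≤ ∣ p ∣ + ∣ q ∣
  ∣p∪q∣≤∣p∣+∣q∣ []            []            = z≤n
  ∣p∪q∣≤∣p∣+∣q∣ (inside  ∷ p) (inside  ∷ q) = s≤s (≤-trans (∣p∪q∣≤∣p∣+∣q∣ p q) (+-monoʳ-≤ ∣ p ∣ (n≤1+n ∣ q ∣)))
  ∣p∪q∣≤∣p∣+∣q∣ (inside  ∷ p) (outside ∷ q) = s≤s (∣p∪q∣≤∣p∣+∣q∣ p q)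
  ∣p∪q∣≤∣p∣+∣q∣ (outside ∷ p) (inside  ∷ q) = ≤-trans (s≤s (∣p∪q∣≤∣p∣+∣q∣ p q)) (≤-reflexive (sym (+-suc ∣ p ∣ ∣ q ∣)))
  ∣p∪q∣≤∣p∣+∣q∣ (outside ∷ p) (outside ∷ q) = ∣p∪q∣≤∣p∣+∣q∣ p q

  outside-member : ∀ {n} (p q : Subset n) → ∣ q ∣ < ∣ p ∣ → ∃[ x ] x ∈ p × x ∉ q
  outside-member p q q<p with Fin.any? (λ x → (x ∈? p) ×-dec ¬? (x ∈? q))
  ... | yes x = x
  ... | no ∄x = contradiction q<p (≤⇒≯ (p⊆q⇒∣p∣≤∣q∣ λ {x} x∈p → decidable-stable (x ∈? q) λ x∉q → ∄x (x , x∈p , x∉q)))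

  -- U collects the colours already taken. Each choice moves one unit from q to |U|, so the size
  -- condition persists.
  greedy-SDR : ∀ {q ℓ} (A : Fin q → Subset ℓ) (U : Subset ℓ) → (∀ i → q + ∣ U ∣ ≤ ∣ A i ∣) →
    Σ[ (a , _) ∈ HasSDR A ] (∀ i → a i ∉ U)
  greedy-SDR {zero}  A U large = ((λ ()) , (λ {}) , λ ()) , λ ()
  greedy-SDR {suc q} A U large
    with outside-member (A zero) U (≤-trans (s≤s (m≤n+m ∣ U ∣ q)) (large zero))
  ... | x , x∈ , x∉U
    with greedy-SDR (A ∘ suc) (U ∪ ⁅ x ⁆) (λ i → ≤-trans
           (+-monoʳ-≤ q (≤-trans (∣p∪q∣≤∣p∣+∣q∣ U ⁅ x ⁆)
             (≤-reflexive (trans (cong (∣ U ∣ +_) (∣⁅x⁆∣≡1 x)) (+-comm ∣ U ∣ 1)))))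
           (≤-trans (≤-reflexive (+-suc q ∣ U ∣)) (large (suc i))))
  ...   | (b , b-inj , b∈) , b∉ = (a , a-inj , a∈) , a∉
    where
    a : Fin (suc q) → Fin _
    a zero    = x
    a (suc i) = b i
    b≢x : ∀ i → b i ≢ x
    b≢x i refl = b∉ i (q⊆p∪q U ⁅ x ⁆ (x∈⁅x⁆ x))
    a-inj : Injective _≡_ _≡_ a
    a-inj {zero}  {zero}  _  = refl
    a-inj {zero}  {suc j} eq = contradiction (sym eq) (b≢x j)
    a-inj {suc i} {zero}  eq = contradiction eq (b≢x i)
    a-inj {suc i} {suc j} eq = cong suc (b-inj eq)
    a∈ : ∀ i → a i ∈ A i
    a∈ zero    = x∈
    a∈ (suc i) = b∈ i
    a∉ : ∀ i → a i ∉ U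
    a∉ zero    = x∉U
    a∉ (suc i) = b∉ i ∘ p⊆p∪q ⁅ x ⁆

  -- The exceptional set, known only to be nonempty, chooses x first. The other q - 1 sets have at
  -- least q = (q - 1) + 1 elements, enough for greedy choices avoiding x.
  almost-large-SDR : ∀ {q ℓ} (A : Fin q → Subset ℓ) i₀ → Nonempty (A i₀) →
    (∀ i → i ≢ i₀ → q ≤ ∣ A i ∣) → HasSDR A
  almost-large-SDR {suc q} A i₀ (x , x∈) large
    with greedy-SDR (A ∘ punchIn i₀) ⁅ x ⁆ (λ i → ≤-trans
           (≤-reflexive (trans (cong (q +_) (∣⁅x⁆∣≡1 x)) (+-comm q 1))) (large (punchIn i₀ i) (Fin.punchInᵢ≢i i₀ i)))
  ... | (b , b-inj , b∈) , b∉ = a , a-inj , a∈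
    where
    -- The decision is an argument so that `assign-inj` can split on two decisions at once.
    assign : ∀ i → Dec (i₀ ≡ i) → Fin _
    assign i (yes _)   = x
    assign i (no i₀≢i) = b (punchOut i₀≢i)
    a : Fin (suc q) → Fin _
    a i = assign i (i₀ Fin.≟ i)
    b≢x : ∀ i → b i ≢ x
    b≢x i refl = b∉ i (x∈⁅x⁆ x)
    assign-inj : ∀ {i j} (d : Dec (i₀ ≡ i)) (d′ : Dec (i₀ ≡ j)) → assign i d ≡ assign j d′ → i ≡ j
    assign-inj (yes refl) (yes refl) _  = refl
    assign-inj (yes _)    (no _)     eq = contradiction (sym eq) (b≢x _)
    assign-inj (no _)     (yes _)    eq = contradiction eq (b≢x _)
    assign-inj (no ≢i)    (no ≢j)    eq = Fin.punchOut-injective ≢i ≢j (b-inj eq)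
    a-inj : Injective _≡_ _≡_ a
    a-inj {i} {j} = assign-inj (i₀ Fin.≟ i) (i₀ Fin.≟ j)
    a∈ : ∀ i → a i ∈ A i
    a∈ i with i₀ Fin.≟ i
    ... | yes refl = x∈
    ... | no i₀≢i  = subst (λ k → b (punchOut i₀≢i) ∈ A k) (Fin.punchIn-punchOut i₀≢i) (b∈ (punchOut i₀≢i))

-- Chromatic numbers after the deletion of edges.

module Chromatic where

  open import Data.Fin.Base using (Fin; zero; suc; inject≤)
  import Data.Fin.Base as Fin
  import Data.Fin.Properties as Fin
  open import Data.Fin.Subset using (Subset; ∣_∣; _∈_; _⊆_; ⁅_⁆; ⊥)
  open import Data.Fin.Subset.Properties using (∣⊥∣≡0; ∣⁅x⁆∣≡1; x∈⁅x⁆; anySubset?)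
  open import Data.List.Base using (List; _∷_; allFin; cartesianProduct; filter; lookup; upTo)
  open import Data.List.Extrema.Nat using (min≤⊤; min≤xs; argmin-sel)
  open import Data.List.Membership.Propositional using () renaming (_∈_ to _∈ˡ_)
  open import Data.List.Membership.Propositional.Properties
    using (∈-filter⁺; ∈-filter⁻; ∈-upTo⁺; ∈-allFin; ∈-cartesianProduct⁺; ∈-lookup)
  import Data.List.Relation.Unary.All as All
  open import Data.List.Relation.Unary.Any using (index)
  open import Data.List.Relation.Unary.Any.Properties using (lookup-index)
  open import Data.List.Relation.Unary.AllPairs using (_∷_)
  open import Data.List.Relation.Unary.Unique.Propositional using (Unique)
  import Data.List.Relation.Unary.Unique.Propositional.Properties as Unique
  open import Data.Nat.Base
  open import Data.Nat.Properties
  open import Data.Product.Base using (∃-syntax; _×_; _,_; proj₁; proj₂)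
  open import Data.Sum.Base using (_⊎_; inj₁; inj₂; [_,_]′)
  open import Defs hiding (_≤_; _+_; _-_)
  open import Defs using () renaming (_-_ to _∖_)
  open import Function.Base using (id)
  open import Relation.Binary.Definitions using (tri<; tri≈; tri>)
  open import Relation.Binary.PropositionalEquality
  open import Relation.Nullary using (yes; no; ¬_; contradiction)
  open import Relation.Nullary.Decidable using (_×-dec_)
  open import Relation.Unary using (Decidable)
  open Representatives using (enlarge; singleton)

  module _ {P : ℕ → Set} (P? : Decidable P) (b : ℕ) where

    least-sel : least P? b ≡ b ⊎ P (least P? b)
    least-sel with argmin-sel id b (filter P? (upTo b))
    ... | inj₁ eq = inj₁ eq
    ... | inj₂ m∈ = inj₂ (proj₂ (∈-filter⁻ P? {xs = upTo b} m∈))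

    least≤bound : least P? b ≤ b
    least≤bound = min≤⊤ b (filter P? (upTo b))

    least≤ : ∀ {m} → P m → least P? b ≤ m
    least≤ {m} Pm with m <? b
    ... | yes m<b = All.lookup (min≤xs b (filter P? (upTo b))) (∈-filter⁺ P? (∈-upTo⁺ m<b) Pm)
    ... | no  m≮b = ≤-trans least≤bound (≮⇒≥ m≮b)

  order-colorable : ∀ G → Colorable G (order G)
  order-colorable G = id , λ { u v a refl → irreflexive G a }

  colorable-mono : ∀ G {m n} → m ≤ n → Colorable G m → Colorable G n
  colorable-mono G m≤n (c , proper) = (λ u → inject≤ (c u) m≤n) ,
    λ u v a eq → proper u v a (Fin.inject≤-injective m≤n m≤n _ _ eq)

  χ-colorable : ∀ G → Colorable G (χ G)
  χ-colorable G with least-sel (colorable? G) (order G)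
  ... | inj₁ eq = subst (Colorable G) (sym eq) (order-colorable G)
  ... | inj₂ c  = c

  module _ (H : Graph) (j : ℕ) where

    private
      P? : Decidable λ m → ∃[ S ] ∣ S ∣ ≡ j × χ (H ∖ S) ≡ m
      P? m = anySubset? λ (S : Subset (e H)) → (∣ S ∣ ≟ j) ×-dec (χ (H ∖ S) ≟ m)

    χⱼ-attained : j ≤ e H → ∃[ S ] ∣ S ∣ ≡ j × Colorable (H ∖ S) (χⱼ j H)
    χⱼ-attained j≤ = [ at-bound , at-witness ]′ (least-sel P? (order H))
      where
      at-bound : χⱼ j H ≡ order H → ∃[ S ] ∣ S ∣ ≡ j × Colorable (H ∖ S) (χⱼ j H)
      -- If the search returns its default `order H`, any j edges may be deleted, since `order H`
      -- colours always suffice.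
      at-bound eq =
        let S , _ , ∣S∣≡j = enlarge {e H} ⊥ (≤-trans (≤-reflexive (∣⊥∣≡0 (e H))) z≤n) j≤ in
        S , ∣S∣≡j , subst (Colorable (H ∖ S)) (sym eq) (order-colorable (H ∖ S))
      at-witness : (∃[ S ] ∣ S ∣ ≡ j × χ (H ∖ S) ≡ χⱼ j H) → ∃[ S ] ∣ S ∣ ≡ j × Colorable (H ∖ S) (χⱼ j H)
      at-witness (S , ∣S∣≡j , χ≡) = S , ∣S∣≡j , subst (Colorable (H ∖ S)) χ≡ (χ-colorable (H ∖ S))

    χⱼ≤ : ∀ S {m} → ∣ S ∣ ≡ j → Colorable (H ∖ S) m → χⱼ j H ≤ m
    χⱼ≤ S ∣S∣≡j c = ≤-trans (least≤ P? (order H) (S , ∣S∣≡j , refl)) (least≤ (colorable? (H ∖ S)) (order H) c)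

  lookup-injective : ∀ {A : Set} {xs : List A} → Unique xs → ∀ i j → lookup xs i ≡ lookup xs j → i ≡ j
  lookup-injective (x∉ ∷ u) zero    zero    _  = refl
  lookup-injective (x∉ ∷ u) zero    (suc j) eq = contradiction eq (All.lookup x∉ (∈-lookup j))
  lookup-injective (x∉ ∷ u) (suc i) zero    eq = contradiction (sym eq) (All.lookup x∉ (∈-lookup i))
  lookup-injective (x∉ ∷ u) (suc i) (suc j) eq = cong suc (lookup-injective u i j eq)

  module _ (H : Graph) where

    private
      IsEdge : Fin (order H) × Fin (order H) → Set
      IsEdge (u , v) = u Fin.< v × Adj H u v

      edge? : Decidable IsEdge
      edge? (u , v) = (u Fin.<? v) ×-dec adj? H u v

      vertex-pairs = cartesianProduct (allFin (order H)) (allFin (order H))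

    ends-spec : ∀ i → let u , v = ends H i in u Fin.< v × Adj H u v
    ends-spec i = proj₂ (∈-filter⁻ edge? {xs = vertex-pairs} (∈-lookup {xs = edges H} i))

    ends-injective : ∀ i j → ends H i ≡ ends H j → i ≡ j
    ends-injective = lookup-injective (Unique.filter⁺ edge? (Unique.cartesianProduct⁺ (Unique.allFin⁺ _) (Unique.allFin⁺ _)))

    -- `ends` stores the smaller vertex first, so the reversed pair cannot occur.
    joins-unique : ∀ i j → let u , v = ends H i in Joins H j u v → j ≡ i
    joins-unique i j (inj₁ eq) = ends-injective j i eq
    joins-unique i j (inj₂ eq) = contradiction
      (subst (λ (u , v) → u Fin.< v) eq (proj₁ (ends-spec j))) (<-asym (proj₁ (ends-spec i)))

    private
      edge-index : ∀ {u v} → u Fin.< v → Adj H u v → ∃[ i ] ends H i ≡ (u , v)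
      edge-index {u} {v} u<v a = index uv∈ , sym (lookup-index uv∈)
        where
        uv∈ : (u , v) ∈ˡ edges H
        uv∈ = ∈-filter⁺ edge? (∈-cartesianProduct⁺ (∈-allFin u) (∈-allFin v)) (u<v , a)

    adjacent⇒joined : ∀ u v → Adj H u v → ∃[ i ] Joins H i u v
    adjacent⇒joined u v a with Fin.<-cmp u v
    ... | tri< u<v _ _  = let i , eq = edge-index u<v a in i , inj₁ eq
    ... | tri≈ _ refl _ = contradiction a (irreflexive H)
    ... | tri> _ _ v<u  = let i , eq = edge-index v<u (symmetric H a) in i , inj₂ eq

    remaining-adjacent : ∀ S i → ¬ i ∈ S → let u , v = ends H i in Adj (H ∖ S) u v
    remaining-adjacent S i i∉S = proj₂ (ends-spec i) , λ (j , j∈S , joins) → i∉S (subst (_∈ S) (joins-unique i j joins) j∈S)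

    delete-more : ∀ {S T k} → S ⊆ T → Colorable (H ∖ S) k → Colorable (H ∖ T) k
    delete-more S⊆T (c , proper) = c , λ u v (a , ¬d) → proper u v (a , λ (i , i∈S , joins) → ¬d (i , S⊆T i∈S , joins))

    χ₁-attained : 1 ≤ e H → ∃[ i ] Colorable (H ∖ ⁅ i ⁆) (χⱼ 1 H)
    χ₁-attained 1≤e =
      let S , ∣S∣≡1 , c = χⱼ-attained H 1 1≤e
          i , _ , unique = singleton S ∣S∣≡1
      in i , delete-more (λ {x} x∈S → subst (_∈ ⁅ i ⁆) (sym (unique x x∈S)) (x∈⁅x⁆ i)) c

    χ₁≤ : ∀ i {m} → Colorable (H ∖ ⁅ i ⁆) m → χⱼ 1 H ≤ m
    χ₁≤ i = χⱼ≤ H 1 ⁅ i ⁆ (∣⁅x⁆∣≡1 i)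

-- The Turán template and the graph of large palettes.

module Templates where

  open Chromatic
  open Counting
  open import Data.Bool.Base using (Bool; true; false; not; _∧_; if_then_else_; T)
  open import Data.Bool.Properties using (T-≡)
  open import Data.Empty using () renaming (⊥ to Absurd)
  open import Data.Fin.Base using (Fin; zero; suc)
  import Data.Fin.Properties as Fin
  open import Data.Fin.Subset using (Subset; ∣_∣; _∈_; ⁅_⁆; Nonempty; ⊤)
  open import Data.Fin.Subset.Properties using (∣⊤∣≡n; x∈⁅y⁆⇒x≡y)
  open import Data.Nat.Base
  open import Data.Nat.Combinatorics using (_C_)
  open import Data.Nat.Properties
  open import Data.Nat.Tactic.RingSolver using (solve-∀)
  open import Data.Product.Base using (∃-syntax; _×_; _,_; proj₁; proj₂)
  open import Data.Sum.Base using (inj₁; inj₂)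
  open import Data.Vec.Base using (tabulate)
  open import Defs hiding (_≤_; _+_; _-_)
  open import Defs using () renaming (_-_ to _∖_)
  open ErdosStone
  open import Function.Base using (_∘_)
  open import Function.Bundles using (Equivalence)
  open import Function.Definitions using (Injective)
  open PairSums
  open import Relation.Binary.PropositionalEquality
  open import Relation.Nullary using (does; yes; no; ¬_; contradiction)
  open import Relation.Nullary.Decidable using (dec-true; dec-false)
  open Representatives

  does-≟-sym : ∀ {n} (x y : Fin n) → does (x Fin.≟ y) ≡ does (y Fin.≟ x)
  does-≟-sym x y with x Fin.≟ y
  ... | yes refl = sym (dec-true (x Fin.≟ x) refl)
  ... | no x≢y   = sym (dec-false (y Fin.≟ x) (x≢y ∘ sym))

  module TuránTemplate {n r} (c : Fin n → Fin r) {j ℓ} (1≤j : 1 ≤ j) (j≤ℓ : j ≤ ℓ) where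

    monochromatic : Fin n → Fin n → Bool
    monochromatic u v = does (c v Fin.≟ c u)

    colours : Bool → Subset ℓ
    colours b = if b then first j else ⊤

    colours-nonempty : ∀ b → Nonempty (colours b)
    colours-nonempty true  = 0<∣p∣⇒Nonempty (first j) (≤-trans 1≤j (≤-reflexive (sym (∣first∣ j≤ℓ))))
    colours-nonempty false = 0<∣p∣⇒Nonempty ⊤ (≤-trans (≤-trans 1≤j j≤ℓ) (≤-reflexive (sym (∣⊤∣≡n ℓ))))

    template : Template n ℓ
    template = record
      { palette     = λ u v → colours (monochromatic u v)
      ; palette-sym = λ u v → cong colours (does-≟-sym (c v) (c u))
      ; nonempty    = λ u v _ → colours-nonempty (monochromatic u v)
      }

    same-colour⇒first : ∀ {u v x} → c u ≡ c v → x ∈ palette template u v → x ∈ first j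
    same-colour⇒first {u} {v} {x} eq = subst (λ b → x ∈ colours b) (dec-true (c v Fin.≟ c u) (sym eq))

  -- In a copy of H with an SDR a, the edges with a i ∈ [j] include all edges
  -- inside a part, so removing them leaves a graph coloured by the parts.

  turán-SDRFree : ∀ H {j ℓ n} (1≤j : 1 ≤ j) (j<e : j < e H) (j≤ℓ : j ≤ ℓ) (c : Fin n → Fin (suc (χⱼ j H ∸ 2))) →
    SDRFree H (TuránTemplate.template c 1≤j j≤ℓ)
  turán-SDRFree H {j} {ℓ} {n} 1≤j j<e j≤ℓ c f f-inj (a , a-inj , a∈) = absurd (χⱼ j H) refl
    where
    open TuránTemplate c 1≤j j≤ℓ using (same-colour⇒first)

    low : Fin (e H) → Bool
    low i = firstℕ j (a i)

    ∣low∣≤j : ∣ tabulate low ∣ ≤ j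
    ∣low∣≤j = ≤-trans (≤-reflexive (∣tabulate∣ low))
      (let g , g-inj , g-low = enumerate low ≤-refl in
       first-injective⇒≤ {f = a ∘ g} (g-inj ∘ a-inj) (λ i → ∈-tabulate⁺ {p = firstℕ j} (g-low i)))

    -- `χⱼ` ranges over sets of exactly j edges, so the low edges are padded; extra deletions keep
    -- the colouring proper.
    larger = enlarge (tabulate low) ∣low∣≤j (<⇒≤ j<e)
    S = proj₁ larger

    low⊆S : ∀ {i} → a i ∈ first j → i ∈ S
    low⊆S {i} ai∈ = proj₁ (proj₂ larger) (∈-tabulate⁺ {p = low} (∈-tabulate⁻ {p = firstℕ j} ai∈))

    same-part⇒low : ∀ i → c (f (proj₁ (ends H i))) ≡ c (f (proj₂ (ends H i))) → a i ∈ first j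
    same-part⇒low i eq = same-colour⇒first eq (a∈ i)

    parts-proper : Proper (H ∖ S) (c ∘ f)
    parts-proper u v (adj , ¬deleted) eq =
      let i , joins = adjacent⇒joined H u v adj in ¬deleted (i , low⊆S (same-part⇒low i (same-part i joins)) , joins)
      where
      same-part : ∀ i → Joins H i u v → c (f (proj₁ (ends H i))) ≡ c (f (proj₂ (ends H i)))
      same-part i (inj₁ uv) = trans (cong (c ∘ f ∘ proj₁) uv) (trans eq (sym (cong (c ∘ f ∘ proj₂) uv)))
      same-part i (inj₂ vu) = trans (cong (c ∘ f ∘ proj₁) vu) (trans (sym eq) (sym (cong (c ∘ f ∘ proj₂) vu)))

    χⱼ≤parts : χⱼ j H ≤ suc (χⱼ j H ∸ 2)
    χⱼ≤parts = χⱼ≤ H j S (proj₂ (proj₂ larger)) (c ∘ f , parts-proper)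

    one-part : suc (χⱼ j H ∸ 2) ≡ 1 → ∀ x y → c x ≡ c y
    one-part eq x y = unique eq (c x) (c y)
      where
      unique : ∀ {m} → m ≡ 1 → (p q : Fin m) → p ≡ q
      unique refl zero zero = refl

    one-part-absurd : suc (χⱼ j H ∸ 2) ≡ 1 → Absurd
    one-part-absurd eq = <⇒≱ j<e (first-injective⇒≤ {f = a} a-inj λ i → same-part⇒low i (one-part eq _ _))

    -- For m ≤ 2 there is one part, all palettes are `first j`, and an SDR would inject e(H) > j
    -- edges into j colours. For m ≥ 3 there are m - 1 parts, and `χⱼ≤parts` reads m ≤ m - 1.
    absurd : ∀ m → χⱼ j H ≡ m → Absurd
    absurd 0 eq = one-part-absurd (cong (λ m → suc (m ∸ 2)) eq)
    absurd 1 eq = one-part-absurd (cong (λ m → suc (m ∸ 2)) eq)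
    absurd 2 eq = one-part-absurd (cong (λ m → suc (m ∸ 2)) eq)
    absurd (suc (suc (suc k))) eq = <-irrefl refl (subst (λ m → m ≤ suc (m ∸ 2)) eq χⱼ≤parts)

  module LargePalettes (H : Graph) {n ℓ} (P : Template n ℓ) where

    -- The diagonal is excluded because `palette` is arbitrary there, while `erdős-stone` is applied
    -- to a loopless graph.
    large : Fin n → Fin n → Bool
    large u v = not (does (u Fin.≟ v)) ∧ (e H ≤ᵇ ∣ palette P u v ∣)

    large-sym : ∀ u v → large u v ≡ large v u
    large-sym u v = cong₂ _∧_ (cong not (does-≟-sym u v)) (cong (λ p → e H ≤ᵇ ∣ p ∣) (palette-sym P u v))

    large-irrefl : ∀ u → large u u ≡ false
    large-irrefl u = cong (λ b → not b ∧ (e H ≤ᵇ ∣ palette P u u ∣)) (dec-true (u Fin.≟ u) refl)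

    large⇒ : ∀ u v → large u v ≡ true → e H ≤ ∣ palette P u v ∣
    large⇒ u v eq = ≤ᵇ⇒≤ (e H) _ (subst T (sym (proj₂ (∧-true {not (does (u Fin.≟ v))} eq))) _)

    ¬large⇒ : ∀ u v → u ≢ v → large u v ≡ false → ∣ palette P u v ∣ ≤ e H ∸ 1
    ¬large⇒ u v u≢v eq = ≤-pred (≤-trans (≰⇒> λ eH≤ → contradiction (trans (sym eq) (both eH≤)) λ ()) (m≤n+m∸n (e H) 1))
      where
      both : e H ≤ ∣ palette P u v ∣ → large u v ≡ true
      both eH≤ = cong₂ (λ x y → not x ∧ y) (dec-false (u Fin.≟ v) u≢v) (Equivalence.to T-≡ (≤⇒≤ᵇ eH≤))

    -- The deleted edge i₀ only has a nonempty palette; it is given a colour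
    -- first and the remaining edges are coloured greedily.

    blowup-free : SDRFree H P → ∀ {k} i₀ → Colorable (H ∖ ⁅ i₀ ⁆) k → ¬ Blowup large k (order H)
    blowup-free free i₀ (c , proper) B = free f f-inj (almost-large-SDR _ i₀
      (nonempty P _ _ λ eq → irreflexive H (subst (Adj H _) (sym (f-inj eq)) (proj₂ (ends-spec H i₀))))
      λ i i≢i₀ → large⇒ _ _ (Blowup.adjacent B _ _
        (proper _ _ (remaining-adjacent H ⁅ i₀ ⁆ i (i≢i₀ ∘ x∈⁅y⁆⇒x≡y i₀))) _ _))
      where
      -- Parts of size `order H` allow u itself as the index inside its part. Images in different
      -- parts are adjacent, hence distinct by looplessness.
      f : Fin (order H) → Fin n
      f u = Blowup.vertex B (c u) u

      f-inj : Injective _≡_ _≡_ f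
      f-inj {u} {v} eq with c u Fin.≟ c v
      ... | yes cu≡cv = Blowup.injective B (c v) (subst (λ i → Blowup.vertex B i u ≡ f v) cu≡cv eq)
      ... | no  cu≢cv = contradiction
        (trans (sym (large-irrefl (f u))) (trans (cong (large (f u)) eq) (Blowup.adjacent B _ _ cu≢cv u v))) λ ()

  -- One order n is fixed before ℓ and the template, large enough for `erdős-stone`, at least
  -- `order H`, and at least 2 so that C(n, 2) is positive.
  few-large : ∀ H R M .{{_ : NonZero M}} .{{_ : NonZero (order H)}} i₀ → Colorable (H ∖ ⁅ i₀ ⁆) (suc (suc R)) →
    ∃[ n ] order H ≤ n × 2 ≤ n × (∀ {ℓ} (P : Template n ℓ) → SDRFree H P → let open LargePalettes H P in
      suc R * M * pairSum n (λ u v → ⟦ large u v ⟧) ≤ (R * M + 2 * suc R) * (n C 2))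
  few-large H R M i₀ c with erdős-stone R M (order H)
  ... | N , sparse = suc k , ≤-trans (m≤n+m (order H) N) (m≤n+m _ 2) , s≤s (s≤s z≤n) , bound
    where
    k = suc (N + order H)
    bound : ∀ {ℓ} (P : Template (suc k) ℓ) → SDRFree H P → let open LargePalettes H P in
      suc R * M * pairSum (suc k) (λ u v → ⟦ large u v ⟧) ≤ (R * M + 2 * suc R) * (suc k C 2)
    bound P free = *-cancelˡ-≤ 2 (begin
      2 * (suc R * M * b)                     ≡⟨ swap 2 (suc R * M) b ⟩
      suc R * M * (2 * b)                     ≡⟨ cong (suc R * M *_) (total-pairSum large large-sym large-irrefl) ⟨
      suc R * M * total large                 ≤⟨ sparse k (≤-trans (m≤m+n N _) (n≤1+n _)) large large-sym large-irrefl
                                                   (blowup-free free i₀ c) ⟩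
      (R * M + 2 * suc R) * (suc k * k)       ≡⟨ cong ((R * M + 2 * suc R) *_) (2*nC2 k) ⟨
      (R * M + 2 * suc R) * (2 * (suc k C 2)) ≡⟨ swap 2 (R * M + 2 * suc R) (suc k C 2) ⟨
      2 * ((R * M + 2 * suc R) * (suc k C 2)) ∎)
      where
      open ≤-Reasoning
      open LargePalettes H P
      b = pairSum (suc k) (λ u v → ⟦ large u v ⟧)
      swap : ∀ x y z → x * (y * z) ≡ y * (x * z)
      swap = solve-∀

-- The lower and upper bounds for `λ[ H , ℓ ]`.

module Bounds where

  open Chromatic
  open Cuts
  open import Data.Bool.Base using (Bool; true; false; not; if_then_else_)
  open import Data.Fin.Base using (Fin)
  import Data.Fin.Base as Fin
  import Data.Fin.Properties as Fin
  open import Data.Fin.Subset using (∣_∣; ⁅_⁆)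
  open import Data.Fin.Subset.Properties using (∣⊤∣≡n; ∣p∣≤n)
  open import Data.List.Base using (allFin; cartesianProduct)
  open import Data.List.Membership.Propositional using (_∈_)
  open import Data.List.Membership.Propositional.Properties using (∈-filter⁻)
  open import Data.Nat.Base as ℕ using (ℕ; zero; suc; _∸_; z≤n; s≤s)
  open import Data.Nat.Combinatorics using (_C_)
  import Data.Nat.Properties as ℕ
  open import Data.Product.Base using (Σ-syntax; ∃-syntax; _×_; _,_; proj₁; proj₂; uncurry)
  open import Data.Rational.Base as ℚ using (ℚ; 0ℚ; 1ℚ)
  import Data.Rational.Properties as ℚ
  open import Data.Rational.Solver using (module +-*-Solver)
  open import Defs
  open ErdosStone
  open import Function.Base using (_∘_)
  open PairSums
  open Rationals
  open import Relation.Binary.PropositionalEquality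
  open import Relation.Nullary.Decidable using (_×-dec_)
  open Representatives using (∣first∣)
  open Templates
  import Data.Integer.Base as ℤ

  open +-*-Solver using (solve; _:+_; _:*_; _:-_; _:=_; con)

  -- Truncated subtraction covers the default case: for m ≤ 2 the formula is 1 - 1/1 = 0. Thus R = m
  -- ∸ 2 can serve as the single parameter.
  turán-eq : ∀ m → turán m ≡ 1ℚ ℚ.- ℤ.+ 1 ℚ./ suc (m ∸ 2)
  turán-eq 0                   = refl
  turán-eq 1                   = refl
  turán-eq 2                   = refl
  turán-eq (suc (suc (suc k))) = refl

  1-turán : ∀ m → 1ℚ ℚ.- turán m ≡ ℤ.+ 1 ℚ./ suc (m ∸ 2)
  1-turán m = trans (cong (λ x → 1ℚ ℚ.- x) (turán-eq m))
    (solve 1 (λ x → con 1ℚ :- (con 1ℚ :- x) := x) refl (ℤ.+ 1 ℚ./ suc (m ∸ 2)))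

  0≤1-turán : ∀ m → 0ℚ ℚ.≤ 1ℚ ℚ.- turán m
  0≤1-turán m = subst (0ℚ ℚ.≤_) (sym (1-turán m)) (ℚ.<⇒≤ (0<recip (suc (m ∸ 2))))

  *-turán : ∀ m → ℕ⇒ℚ (suc (m ∸ 2)) ℚ.* turán m ≡ ℕ⇒ℚ (m ∸ 2)
  *-turán m = begin
    n ℚ.* turán m                   ≡⟨ cong (n ℚ.*_) (turán-eq m) ⟩
    n ℚ.* (1ℚ ℚ.- y)                ≡⟨ solve 2 (λ n y → n :* (con 1ℚ :- y) := n :- n :* y) refl n y ⟩
    n ℚ.- n ℚ.* y                   ≡⟨ cong (ℚ._- n ℚ.* y) (ℕ⇒ℚ-+ 1 (m ∸ 2)) ⟩
    1ℚ ℚ.+ ℕ⇒ℚ (m ∸ 2) ℚ.- n ℚ.* y  ≡⟨ cong (λ x → 1ℚ ℚ.+ ℕ⇒ℚ (m ∸ 2) ℚ.- x) (*-recip (suc (m ∸ 2))) ⟩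
    1ℚ ℚ.+ ℕ⇒ℚ (m ∸ 2) ℚ.- 1ℚ       ≡⟨ solve 1 (λ x → con 1ℚ :+ x :- con 1ℚ := x) refl (ℕ⇒ℚ (m ∸ 2)) ⟩
    ℕ⇒ℚ (m ∸ 2)                     ∎
    where
    open ≡-Reasoning
    n = ℕ⇒ℚ (suc (m ∸ 2))
    y = ℤ.+ 1 ℚ./ suc (m ∸ 2)

  0≤turán : ∀ m → 0ℚ ℚ.≤ turán m
  0≤turán m = *-cancelˡ-≤ (0<ℕ⇒ℚ (suc (m ∸ 2))) (subst₂ ℚ._≤_
    (sym (ℚ.*-zeroʳ (ℕ⇒ℚ (suc (m ∸ 2))))) (sym (*-turán m)) (0≤ℕ⇒ℚ (m ∸ 2)))

  archimedean-* : ∀ x {d} → 0ℚ ℚ.< d → ∃[ n ] x ℚ.< ℕ⇒ℚ (suc n) ℚ.* d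
  archimedean-* x {d} 0<d =
    let n , x/d≤n = archimedean (x ℚ.* 1/d) in n , (begin-strict
      x                         ≡⟨ ℚ.*-identityʳ x ⟨
      x ℚ.* 1ℚ                  ≡⟨ cong (x ℚ.*_) (ℚ.*-inverseˡ d) ⟨
      x ℚ.* (1/d ℚ.* d)         ≡⟨ ℚ.*-assoc x 1/d d ⟨
      x ℚ.* 1/d ℚ.* d           ≤⟨ *-monoʳ-≤ (ℚ.<⇒≤ 0<d) x/d≤n ⟩
      ℕ⇒ℚ n ℚ.* d               <⟨ ℚ.*-monoˡ-<-pos d {{ℚ.positive 0<d}} (ℕ⇒ℚ-mono-< (ℕ.n<1+n n)) ⟩
      ℕ⇒ℚ (suc n) ℚ.* d         ∎)
    where
    open ℚ.≤-Reasoning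
    instance
      d≢0 : ℚ.NonZero d
      d≢0 = ℚ.>-nonZero 0<d
    1/d = ℚ.1/ d

  sup-least : ∀ {I : Set} (x : I → ℝ) y → (∀ i → x i ≤ y) → sup x ≤ y
  sup-least x y x≤y q y<q = let p , p<q , y<p = ℝ.rounded y y<q in
    p , (λ i → <ℚ⇒≤fromℚ (x i) (x≤y i p y<p)) , p<q

  -- The sum is nonnegative, so r ≥ 0 and r b ≤ r N. Then `mix-mono` reduces the weight of the
  -- larger value a from m to π N, and N cancels.
  mean≤ : ∀ {π m m′ a c r b N} → 0ℚ ℚ.≤ c → c ℚ.≤ a → 0ℚ ℚ.≤ m → 0ℚ ℚ.≤ m′ → 0ℚ ℚ.< b → b ℚ.≤ N →
    m ℚ.+ m′ ≡ N → π ℚ.* N ℚ.≤ m → m ℚ.* a ℚ.+ m′ ℚ.* c ℚ.≤ r ℚ.* b → π ℚ.* a ℚ.+ (1ℚ ℚ.- π) ℚ.* c ℚ.≤ r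
  mean≤ {π} {m} {m′} {a} {c} {r} {b} {N} 0≤c c≤a 0≤m 0≤m′ 0<b b≤N m+m′≡N πN≤m sum≤ =
    *-cancelˡ-≤ (ℚ.<-≤-trans 0<b b≤N) (begin
      N ℚ.* (π ℚ.* a ℚ.+ (1ℚ ℚ.- π) ℚ.* c)
        ≡⟨ solve 4 (λ N π a c → N :* (π :* a :+ (con 1ℚ :- π) :* c) := π :* N :* a :+ (con 1ℚ :- π) :* N :* c) refl N π a c ⟩
      π ℚ.* N ℚ.* a ℚ.+ (1ℚ ℚ.- π) ℚ.* N ℚ.* c
        ≤⟨ mix-mono c≤a πN≤m (trans (solve 2 (λ π N → π :* N :+ (con 1ℚ :- π) :* N := N) refl π N) (sym m+m′≡N)) ⟩
      m ℚ.* a ℚ.+ m′ ℚ.* c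
        ≤⟨ sum≤ ⟩
      r ℚ.* b
        ≤⟨ *-monoˡ-≤ 0≤r b≤N ⟩
      r ℚ.* N
        ≡⟨ ℚ.*-comm r N ⟩
      N ℚ.* r ∎)
    where
    open ℚ.≤-Reasoning
    0≤r : 0ℚ ℚ.≤ r
    0≤r = *-cancelˡ-≤ 0<b (begin
      b ℚ.* 0ℚ               ≡⟨ ℚ.*-zeroʳ b ⟩
      0ℚ                     ≤⟨ 0≤+ (0≤* 0≤m (ℚ.≤-trans 0≤c c≤a)) (0≤* 0≤m′ 0≤c) ⟩
      m ℚ.* a ℚ.+ m′ ℚ.* c   ≤⟨ sum≤ ⟩
      r ℚ.* b                ≡⟨ ℚ.*-comm r b ⟩
      b ℚ.* r                ∎)

  log-pos : ∀ n {q} → log n <ℚ q → 0ℚ ℚ.≤ q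
  log-pos n n<q = ℚ.<⇒≤ (fromℚ< (0≤log n _ n<q))

  -- From (R + 1) x ≤ N = x + y follows R N ≤ (R + 1) y, and `turán m` is R / (R + 1).
  cross-edges≥ : ∀ m {x y N} → suc (m ∸ 2) ℕ.* x ℕ.≤ N → x ℕ.+ y ≡ N → turán m ℚ.* ℕ⇒ℚ N ℚ.≤ ℕ⇒ℚ y
  cross-edges≥ m {x} {y} {N} mono≤ x+y≡N = *-cancelˡ-≤ (0<ℕ⇒ℚ (suc R)) (begin
    ℕ⇒ℚ (suc R) ℚ.* (turán m ℚ.* ℕ⇒ℚ N)   ≡⟨ ℚ.*-assoc (ℕ⇒ℚ (suc R)) (turán m) (ℕ⇒ℚ N) ⟨
    ℕ⇒ℚ (suc R) ℚ.* turán m ℚ.* ℕ⇒ℚ N     ≡⟨ cong (ℚ._* ℕ⇒ℚ N) (*-turán m) ⟩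
    ℕ⇒ℚ R ℚ.* ℕ⇒ℚ N                       ≡⟨ ℕ⇒ℚ-* R N ⟨
    ℕ⇒ℚ (R ℕ.* N)                         ≤⟨ ℕ⇒ℚ-mono-≤ RN≤ ⟩
    ℕ⇒ℚ (suc R ℕ.* y)                     ≡⟨ ℕ⇒ℚ-* (suc R) y ⟩
    ℕ⇒ℚ (suc R) ℚ.* ℕ⇒ℚ y                 ∎)
    where
    R = m ∸ 2
    open ℚ.≤-Reasoning
    RN≤ : R ℕ.* N ℕ.≤ suc R ℕ.* y
    RN≤ = ℕ.+-cancelˡ-≤ N _ _ (ℕ.≤-trans
      (ℕ.≤-reflexive (trans (cong (suc R ℕ.*_) (sym x+y≡N)) (ℕ.*-distribˡ-+ (suc R) x y)))
      (ℕ.+-monoˡ-≤ (suc R ℕ.* y) mono≤))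

  -- A rational above `λ[ H , ℓ ]` unpacks to an n, a rational p above all weights on K_n and a
  -- divisor b ≤ C(n, 2). In particular p exceeds the weight of the Turán template, which `Σℝ-lower`
  -- and `mean≤` turn into the weighted mean.
  lower-bound : ∀ H ℓ → e H ℕ.≤ ℓ → ∀ j → 1 ℕ.≤ j → j ℕ.< e H →
    πⱼ j H · log ℓ + (1ℚ ℚ.- πⱼ j H) · log j ≤ λ[ H , ℓ ]
  lower-bound H ℓ e≤ℓ j 1≤j j<e q
    (_ , ((n , _) , (r , (p , b , (_ , ub , p₁<p) , 0<b , b≤N , p≤rb) , r<)) , <q) =
    mix-intro π (1ℚ ℚ.- π) (log ℓ) (log j) ℓ<c j<a′
      (ℚ.≤-<-trans (mean≤ {π = π} (log-pos j j<a′) (ℚ.p⊓q≤q a c) (0≤ℕ⇒ℚ y) (0≤ℕ⇒ℚ x) 0<b (fromℚ-cancel-≤ b≤N)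
        (trans (sym (ℕ⇒ℚ-+ y x)) (cong ℕ⇒ℚ (trans (ℕ.+-comm y x) x+y≡N)))
        (cross-edges≥ (χⱼ j H) mono≤ x+y≡N) sum≤) (ℚ.<-trans r< <q))
    where
    π = πⱼ j H
    j≤ℓ = ℕ.≤-trans (ℕ.<⇒≤ j<e) e≤ℓ
    colouring = equitable-colouring (χⱼ j H ∸ 2) n
    col = proj₁ colouring
    mono≤ = proj₂ colouring
    open TuránTemplate col 1≤j j≤ℓ
    mono = uncurry monochromatic
    x = # mono (edges (K n))
    y = # (not ∘ mono) (edges (K n))
    x+y≡N : x ℕ.+ y ≡ n C 2
    x+y≡N = trans (#-complement mono (edges (K n))) (length-edges-K n)
    size : Fin n × Fin n → ℕ
    size (u , v) = ∣ palette template u v ∣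
    inside : ∀ i → mono i ≡ true → log j ≤ log (size i)
    inside i eq = log-mono-≤ j (size i) (ℕ.≤-reflexive (sym (trans (cong (∣_∣ ∘ colours) eq) (∣first∣ j≤ℓ))))
    across : ∀ i → mono i ≡ false → log ℓ ≤ log (size i)
    across i eq = log-mono-≤ ℓ (size i) (ℕ.≤-reflexive (sym (trans (cong (∣_∣ ∘ colours) eq) (∣⊤∣≡n ℓ))))
    weight<p : weight template <ℚ p
    weight<p = ub (template , turán-SDRFree H 1≤j j<e j≤ℓ col) p (_ , refl , p₁<p)
    averages = Σℝ-lower (log ∘ size) mono (log j) (log ℓ) (log<suc j) (log<suc ℓ) inside across (edges (K n)) weight<p
    a = proj₁ averages
    c = proj₁ (proj₂ averages)
    j<a : log j <ℚ a
    j<a = proj₁ (proj₂ (proj₂ averages))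
    ℓ<c : log ℓ <ℚ c
    ℓ<c = proj₁ (proj₂ (proj₂ (proj₂ averages)))
    -- `mean≤` needs the value inside the parts to be at most the value across them; log j ≤ log ℓ
    -- keeps the minimum above log j.
    a′ = a ℚ.⊓ c
    j<a′ : log j <ℚ a′
    j<a′ = ⊓-<ℚ (log j) j<a (log-mono-≤ j ℓ j≤ℓ c ℓ<c)
    open ℚ.≤-Reasoning
    sum≤ : ℕ⇒ℚ y ℚ.* c ℚ.+ ℕ⇒ℚ x ℚ.* a′ ℚ.≤ r ℚ.* b
    sum≤ = begin
      ℕ⇒ℚ y ℚ.* c ℚ.+ ℕ⇒ℚ x ℚ.* a′     ≤⟨ ℚ.+-monoʳ-≤ (ℕ⇒ℚ y ℚ.* c) (*-monoˡ-≤ (0≤ℕ⇒ℚ x) (ℚ.p⊓q≤p a c)) ⟩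
      ℕ⇒ℚ y ℚ.* c ℚ.+ ℕ⇒ℚ x ℚ.* a      ≡⟨ ℚ.+-comm (ℕ⇒ℚ y ℚ.* c) (ℕ⇒ℚ x ℚ.* a) ⟩
      ℕ⇒ℚ x ℚ.* a ℚ.+ ℕ⇒ℚ y ℚ.* c      ≤⟨ proj₂ (proj₂ (proj₂ (proj₂ averages))) ⟩
      p                                ≤⟨ p≤rb ⟩
      r ℚ.* b                          ∎

  large-edges≤ : ∀ m M .{{_ : ℕ.NonZero M}} {x N} → suc (m ∸ 2) ℕ.* M ℕ.* x ℕ.≤ ((m ∸ 2) ℕ.* M ℕ.+ 2 ℕ.* suc (m ∸ 2)) ℕ.* N →
    ℕ⇒ℚ x ℚ.≤ (turán m ℚ.+ ℕ⇒ℚ 2 ℚ.* (ℤ.+ 1 ℚ./ M)) ℚ.* ℕ⇒ℚ N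
  large-edges≤ m M {x} {N} few = *-cancelˡ-≤ (0<ℕ⇒ℚ (suc R ℕ.* M) {{ℕ.m*n≢0 (suc R) M}}) (begin
    ℕ⇒ℚ (suc R ℕ.* M) ℚ.* ℕ⇒ℚ x                   ≡⟨ ℕ⇒ℚ-* (suc R ℕ.* M) x ⟨
    ℕ⇒ℚ (suc R ℕ.* M ℕ.* x)                       ≤⟨ ℕ⇒ℚ-mono-≤ few ⟩
    ℕ⇒ℚ ((R ℕ.* M ℕ.+ 2 ℕ.* suc R) ℕ.* N)         ≡⟨ ℕ⇒ℚ-* (R ℕ.* M ℕ.+ 2 ℕ.* suc R) N ⟩
    ℕ⇒ℚ (R ℕ.* M ℕ.+ 2 ℕ.* suc R) ℚ.* ℕ⇒ℚ N       ≡⟨ cong (ℚ._* ℕ⇒ℚ N) density ⟩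
    ℕ⇒ℚ (suc R ℕ.* M) ℚ.* ρ ℚ.* ℕ⇒ℚ N             ≡⟨ ℚ.*-assoc (ℕ⇒ℚ (suc R ℕ.* M)) ρ (ℕ⇒ℚ N) ⟩
    ℕ⇒ℚ (suc R ℕ.* M) ℚ.* (ρ ℚ.* ℕ⇒ℚ N)           ∎)
    where
    open ℚ.≤-Reasoning
    R = m ∸ 2
    ε = ℤ.+ 1 ℚ./ M
    ρ = turán m ℚ.+ ℕ⇒ℚ 2 ℚ.* ε
    density : ℕ⇒ℚ (R ℕ.* M ℕ.+ 2 ℕ.* suc R) ≡ ℕ⇒ℚ (suc R ℕ.* M) ℚ.* ρ
    density = begin-equality
      ℕ⇒ℚ (R ℕ.* M ℕ.+ 2 ℕ.* suc R)
        ≡⟨ trans (ℕ⇒ℚ-+ (R ℕ.* M) (2 ℕ.* suc R)) (cong₂ ℚ._+_ (ℕ⇒ℚ-* R M) (ℕ⇒ℚ-* 2 (suc R))) ⟩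
      ℕ⇒ℚ R ℚ.* ℕ⇒ℚ M ℚ.+ ℕ⇒ℚ 2 ℚ.* ℕ⇒ℚ (suc R)
        ≡⟨ cong₂ (λ x y → x ℚ.* ℕ⇒ℚ M ℚ.+ ℕ⇒ℚ 2 ℚ.* y)
             (sym (*-turán m)) (sym (trans (cong (ℕ⇒ℚ (suc R) ℚ.*_) (*-recip M)) (ℚ.*-identityʳ (ℕ⇒ℚ (suc R))))) ⟩
      ℕ⇒ℚ (suc R) ℚ.* turán m ℚ.* ℕ⇒ℚ M ℚ.+ ℕ⇒ℚ 2 ℚ.* (ℕ⇒ℚ (suc R) ℚ.* (ℕ⇒ℚ M ℚ.* ε))
        ≡⟨ solve 5 (λ r t m u ε → r :* t :* m :+ u :* (r :* (m :* ε)) := r :* m :* (t :+ u :* ε)) refl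
             (ℕ⇒ℚ (suc R)) (turán m) (ℕ⇒ℚ M) (ℕ⇒ℚ 2) ε ⟩
      ℕ⇒ℚ (suc R) ℚ.* ℕ⇒ℚ M ℚ.* ρ
        ≡⟨ cong (ℚ._* ρ) (ℕ⇒ℚ-* (suc R) M) ⟨
      ℕ⇒ℚ (suc R ℕ.* M) ℚ.* ρ ∎

  -- Raising π by 2/M raises the mean v by (2/M)(a - c), so any M with M (q - v) > 2 (a - c) fits
  -- into the gap.
  small-perturbation : ∀ π {a c q} → π ℚ.* a ℚ.+ (1ℚ ℚ.- π) ℚ.* c ℚ.< q → ∃[ M ] Σ[ M≢0 ∈ ℕ.NonZero M ]
    let ρ = π ℚ.+ ℕ⇒ℚ 2 ℚ.* (ℚ._/_ (ℤ.+ 1) M {{M≢0}}) in ρ ℚ.* a ℚ.+ (1ℚ ℚ.- ρ) ℚ.* c ℚ.< q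
  small-perturbation π {a} {c} {q} v<q =
    let k , lt = archimedean-* (ℕ⇒ℚ 2 ℚ.* (a ℚ.- c)) 0<q-v in suc k , _ , (begin-strict
      (π ℚ.+ ℕ⇒ℚ 2 ℚ.* ε k) ℚ.* a ℚ.+ (1ℚ ℚ.- (π ℚ.+ ℕ⇒ℚ 2 ℚ.* ε k)) ℚ.* c
        ≡⟨ solve 5 (λ π u ε a c → (π :+ u :* ε) :* a :+ (con 1ℚ :- (π :+ u :* ε)) :* c
             := π :* a :+ (con 1ℚ :- π) :* c :+ ε :* (u :* (a :- c))) refl π (ℕ⇒ℚ 2) (ε k) a c ⟩
      v ℚ.+ ε k ℚ.* (ℕ⇒ℚ 2 ℚ.* (a ℚ.- c))
        <⟨ ℚ.+-monoʳ-< v (*-monoˡ-< (0<recip (suc k)) lt) ⟩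
      v ℚ.+ ε k ℚ.* (ℕ⇒ℚ (suc k) ℚ.* (q ℚ.- v))
        ≡⟨ solve 4 (λ v ε k q → v :+ ε :* (k :* (q :- v)) := v :+ k :* ε :* (q :- v)) refl v (ε k) (ℕ⇒ℚ (suc k)) q ⟩
      v ℚ.+ ℕ⇒ℚ (suc k) ℚ.* ε k ℚ.* (q ℚ.- v)
        ≡⟨ cong (λ x → v ℚ.+ x ℚ.* (q ℚ.- v)) (*-recip (suc k)) ⟩
      v ℚ.+ 1ℚ ℚ.* (q ℚ.- v)
        ≡⟨ solve 2 (λ v q → v :+ con 1ℚ :* (q :- v) := q) refl v q ⟩
      q ∎)
    where
    open ℚ.≤-Reasoning
    v = π ℚ.* a ℚ.+ (1ℚ ℚ.- π) ℚ.* c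
    ε : ℕ → ℚ
    ε k = ℤ.+ 1 ℚ./ suc k
    0<q-v : 0ℚ ℚ.< q ℚ.- v
    0<q-v = subst (ℚ._< q ℚ.- v) (ℚ.+-inverseʳ v) (ℚ.+-monoˡ-< (ℚ.- v) v<q)

  weight≤ : ∀ H {n ℓ} (P : Template n ℓ) {a c} → log ℓ <ℚ a → log (e H ∸ 1) <ℚ c → let open LargePalettes H P in
    weight P ≤ fromℚ (ℕ⇒ℚ (# (uncurry large) (edges (K n))) ℚ.* a ℚ.+ ℕ⇒ℚ (# (not ∘ uncurry large) (edges (K n))) ℚ.* c)
  weight≤ H {n} {ℓ} P {a} {c} ℓ<a e<c =
    Σℝ-upper (log ∘ size) (uncurry large) (edges (K n)) λ {i} i∈ → bound i (distinct i i∈) (uncurry large i) refl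
    where
    open LargePalettes H P
    size : Fin n × Fin n → ℕ
    size (u , v) = ∣ palette P u v ∣
    distinct : ∀ i → i ∈ edges (K n) → proj₁ i ≢ proj₂ i
    distinct i i∈ = proj₂ (proj₂ (∈-filter⁻ (λ (u , v) → (u Fin.<? v) ×-dec adj? (K n) u v)
      {xs = cartesianProduct (allFin n) (allFin n)} i∈))
    bound : ∀ i → proj₁ i ≢ proj₂ i → ∀ b → uncurry large i ≡ b → log (size i) ≤ fromℚ (if b then a else c)
    bound i _   true  _  = ≤-trans (log (size i)) (log ℓ) (fromℚ a)
      (log-mono-≤ (size i) ℓ (∣p∣≤n (palette P (proj₁ i) (proj₂ i)))) (<ℚ⇒≤fromℚ (log ℓ) ℓ<a)
    bound i u≢v false eq = ≤-trans (log (size i)) (log (e H ∸ 1)) (fromℚ c)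
      (log-mono-≤ (size i) (e H ∸ 1) (¬large⇒ (proj₁ i) (proj₂ i) u≢v eq))
      (<ℚ⇒≤fromℚ (log (e H ∸ 1)) e<c)

  weight≤-density : ∀ H {n ℓ} (P : Template n ℓ) ρ {a c} → c ℚ.≤ a → log ℓ <ℚ a → log (e H ∸ 1) <ℚ c →
    ℕ⇒ℚ (# (uncurry (LargePalettes.large H P)) (edges (K n))) ℚ.≤ ρ ℚ.* ℕ⇒ℚ (n C 2) →
    weight P ≤ fromℚ ((ρ ℚ.* a ℚ.+ (1ℚ ℚ.- ρ) ℚ.* c) ℚ.* ℕ⇒ℚ (n C 2))
  weight≤-density H {n} P ρ {a} {c} c≤a ℓ<a e<c few =
    ≤-trans (weight P) (fromℚ (ℕ⇒ℚ x ℚ.* a ℚ.+ ℕ⇒ℚ y ℚ.* c)) (fromℚ ((ρ ℚ.* a ℚ.+ (1ℚ ℚ.- ρ) ℚ.* c) ℚ.* N))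
      (weight≤ H P ℓ<a e<c) λ q lt → _ , refl , ℚ.≤-<-trans (begin
      ℕ⇒ℚ x ℚ.* a ℚ.+ ℕ⇒ℚ y ℚ.* c
        ≤⟨ mix-mono c≤a few (trans x+y≡N (solve 2 (λ ρ N → N := ρ :* N :+ (con 1ℚ :- ρ) :* N) refl ρ N)) ⟩
      ρ ℚ.* N ℚ.* a ℚ.+ (1ℚ ℚ.- ρ) ℚ.* N ℚ.* c
        ≡⟨ solve 4 (λ ρ N a c → ρ :* N :* a :+ (con 1ℚ :- ρ) :* N :* c := (ρ :* a :+ (con 1ℚ :- ρ) :* c) :* N) refl ρ N a c ⟩
      (ρ ℚ.* a ℚ.+ (1ℚ ℚ.- ρ) ℚ.* c) ℚ.* N ∎) (fromℚ< lt)
    where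
    open ℚ.≤-Reasoning
    large = uncurry (LargePalettes.large H P)
    x = # large (edges (K n))
    y = # (not ∘ large) (edges (K n))
    N = ℕ⇒ℚ (n C 2)
    x+y≡N : ℕ⇒ℚ x ℚ.+ ℕ⇒ℚ y ≡ N
    x+y≡N = trans (sym (ℕ⇒ℚ-+ x y)) (cong ℕ⇒ℚ (trans (#-complement large (edges (K n))) (length-edges-K n)))

  -- `erdős-stone` works with R + 2 parts, and 2 + (χ₁ ∸ 2) is the maximum of χ₁ and 2.
  colours₁ : ∀ H → 1 ℕ.≤ e H → ∃[ i ] Colorable (H - ⁅ i ⁆) (suc (suc (χⱼ 1 H ∸ 2)))
  colours₁ H 1≤e = let i , c = χ₁-attained H 1≤e in i , colorable-mono (H - ⁅ i ⁆) (ℕ.m≤n+m∸n (χⱼ 1 H) 2) c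

  order≢0 : ∀ H → 1 ℕ.≤ e H → ℕ.NonZero (order H)
  order≢0 H 1≤e = Fin.nonZeroIndex (proj₁ (ends H (Fin.fromℕ< 1≤e)))

  0<nC2 : ∀ n → 2 ℕ.≤ n → 0 ℕ.< n C 2
  0<nC2 (suc (suc n)) _ = subst (0 ℕ.<_) (sym (nC2-suc (suc n))) (s≤s z≤n)
  0<nC2 1 (s≤s ())

  λ-intro : ∀ H ℓ n → order H ℕ.≤ n → 0 ℕ.< n C 2 → ∀ w {q} → w ℚ.< q →
    (∀ (P : Template n ℓ) → SDRFree H P → weight P ≤ fromℚ (w ℚ.* ℕ⇒ℚ (n C 2))) → λ[ H , ℓ ] <ℚ q
  λ-intro H ℓ n o≤n 0<N w w<q ub =
    -- `exlog`, `÷` and `inf` each cost one strict inequality, so two points separate w from q.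
    let q₁ , w<q₁ , q₁<q = ℚ.<-dense w<q
        q₂ , q₁<q₂ , q₂<q = ℚ.<-dense q₁<q
    in q₂ , ((n , o≤n) , (q₁ , (q₁ ℚ.* N , N ,
         (w ℚ.* N , (λ (P , free) → ub P free) , ℚ.*-monoˡ-<-pos N {{ℚ.positive 0<ι}} w<q₁) ,
         0<ι , (λ q N<q → N<q) , ℚ.≤-refl) , q₁<q₂)) , q₂<q
    where
    N = ℕ⇒ℚ (n C 2)
    0<ι : 0ℚ ℚ.< N
    0<ι = ℕ⇒ℚ-mono-< {0} 0<N

  -- All choices depend on q: rationals a and c above the two logarithms with mean below q, then M
  -- for the error 2/M, then n from `few-large`.
  upper-bound : ∀ H ℓ → 1 ℕ.≤ e H → e H ℕ.≤ ℓ → λ[ H , ℓ ] ≤ π₋ H · log ℓ + (1ℚ ℚ.- π₋ H) · log (e H ∸ 1)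
  upper-bound H ℓ 1≤e e≤ℓ q mix<q =
    λ-intro H ℓ n (proj₁ (proj₂ host)) (0<nC2 n (proj₁ (proj₂ (proj₂ host)))) (ρ ℚ.* a ℚ.+ (1ℚ ℚ.- ρ) ℚ.* c′) w<q λ P free →
      weight≤-density H P ρ (ℚ.p⊓q≤p a c) ℓ<a e<c′ (large-edges≤ (χⱼ 1 H) M (proj₂ (proj₂ (proj₂ host)) P free))
    where
    π = π₋ H
    means = mix-elim π (1ℚ ℚ.- π) (log ℓ) (log (e H ∸ 1)) mix<q
    a = proj₁ means
    c = proj₁ (proj₂ means)
    ℓ<a : log ℓ <ℚ a
    ℓ<a = proj₁ (proj₂ (proj₂ means))
    e<c : log (e H ∸ 1) <ℚ c
    e<c = proj₁ (proj₂ (proj₂ (proj₂ means)))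
    -- `mix-mono` requires c′ ≤ a; e(H) - 1 ≤ ℓ keeps c′ above log (e(H) - 1).
    c′ = a ℚ.⊓ c
    e<c′ : log (e H ∸ 1) <ℚ c′
    e<c′ = ⊓-<ℚ (log (e H ∸ 1)) (log-mono-≤ (e H ∸ 1) ℓ (ℕ.≤-trans (ℕ.m∸n≤m (e H) 1) e≤ℓ) a ℓ<a) e<c
    perturbed = small-perturbation π {a} {c′} {q} (ℚ.≤-<-trans
      (ℚ.+-monoʳ-≤ (π ℚ.* a) (*-monoˡ-≤ (0≤1-turán (χⱼ 1 H)) (ℚ.p⊓q≤q a c))) (proj₂ (proj₂ (proj₂ (proj₂ means)))))
    M = proj₁ perturbed
    instance
      M≢0 : ℕ.NonZero M
      M≢0 = proj₁ (proj₂ perturbed)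
      o≢0 : ℕ.NonZero (order H)
      o≢0 = order≢0 H 1≤e
    ρ = π ℚ.+ ℕ⇒ℚ 2 ℚ.* (ℤ.+ 1 ℚ./ M)
    w<q : ρ ℚ.* a ℚ.+ (1ℚ ℚ.- ρ) ℚ.* c′ ℚ.< q
    w<q = proj₂ (proj₂ perturbed)
    host = few-large H (χⱼ 1 H ∸ 2) M (proj₁ (colours₁ H 1≤e)) (proj₂ (colours₁ H 1≤e))
    n = proj₁ host

-- The limit and the case of equality.

module Limits where

  open Bounds
  open Chromatic
  open Cuts
  open import Data.Fin.Base using (Fin)
  open import Data.Fin.Subset using (⁅_⁆)
  open import Data.Nat.Base as ℕ using (ℕ; suc; _∸_; z≤n; s≤s)
  import Data.Nat.Properties as ℕ
  open import Data.Product.Base using (∃-syntax; _×_; _,_; proj₁; proj₂)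
  open import Data.Rational.Base as ℚ using (ℚ; 0ℚ; 1ℚ)
  import Data.Rational.Properties as ℚ
  open import Data.Rational.Solver using (module +-*-Solver)
  open import Defs
  open Rationals
  open import Relation.Binary.PropositionalEquality

  open +-*-Solver using (solve; _:+_; _:*_; _:-_; _:=_; con)

  turán*≤ : ∀ m {a c} → 0ℚ ℚ.≤ c → turán m ℚ.* a ℚ.≤ turán m ℚ.* a ℚ.+ (1ℚ ℚ.- turán m) ℚ.* c
  turán*≤ m 0≤c = p≤p+q (0≤* (0≤1-turán m) 0≤c)

  turán≤1 : ∀ m → turán m ℚ.≤ 1ℚ
  turán≤1 m = subst (ℚ._≤ 1ℚ) (ℚ.+-identityʳ (turán m)) (subst (turán m ℚ.+ 0ℚ ℚ.≤_)
    (solve 1 (λ x → x :+ (con 1ℚ :- x) := con 1ℚ) refl (turán m)) (ℚ.+-monoʳ-≤ (turán m) (0≤1-turán m)))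

  min≤mean : ∀ m a c → a ℚ.⊓ c ℚ.≤ turán m ℚ.* a ℚ.+ (1ℚ ℚ.- turán m) ℚ.* c
  min≤mean m a c = begin
    b                             ≡⟨ solve 2 (λ π b → b := π :* b :+ (con 1ℚ :- π) :* b) refl π b ⟩
    π ℚ.* b ℚ.+ (1ℚ ℚ.- π) ℚ.* b  ≤⟨ ℚ.+-mono-≤ (*-monoˡ-≤ (0≤turán m) (ℚ.p⊓q≤p a c)) (*-monoˡ-≤ (0≤1-turán m) (ℚ.p⊓q≤q a c)) ⟩
    π ℚ.* a ℚ.+ (1ℚ ℚ.- π) ℚ.* c  ∎
    where
    open ℚ.≤-Reasoning
    π = turán m
    b = a ℚ.⊓ c

  -- The lower bound for j = 1, where log j = 0.

  turán·log≤ : ∀ H ℓ → 2 ℕ.≤ e H → e H ℕ.≤ ℓ → ∀ {p} → λ[ H , ℓ ] <ℚ p → ∃[ a ] log ℓ <ℚ a × π₋ H ℚ.* a ℚ.< p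
  turán·log≤ H ℓ 2≤e e≤ℓ λ<p =
    let a , c , ℓ<a , 1<c , mean<p = mix-elim (π₋ H) (1ℚ ℚ.- π₋ H) (log ℓ) (log 1) (lower-bound H ℓ e≤ℓ 1 (s≤s z≤n) 2≤e _ λ<p)
    in a , ℓ<a , ℚ.≤-<-trans (turán*≤ (χⱼ 1 H) (log-pos 1 1<c)) mean<p

  -- A quotient witness has b ≤ log ℓ < a and p ≤ r b. Hence π b ≤ π a < p ≤ r b, and b cancels.
  ratio-lower : ∀ H ℓ → 2 ℕ.≤ e H → e H ℕ.≤ ℓ → ∀ ε → 0ℚ ℚ.< ε → fromℚ (π₋ H) ≤ λ[ H , ℓ ] ÷ log ℓ + fromℚ ε
  ratio-lower H ℓ 2≤e e≤ℓ ε 0<ε q (_ , (p₁ , p₂ , (r , (p , b , λ<p , 0<b , b≤ , p≤rb) , r<p₁) , ε<p₂ , refl) , <q) =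
    let a , ℓ<a , πa<p = turán·log≤ H ℓ 2≤e e≤ℓ λ<p in
    _ , refl , (begin-strict
      π₋ H           ≤⟨ *-cancelˡ-≤ 0<b (b*π≤b*r a ℓ<a πa<p) ⟩
      r              <⟨ r<p₁ ⟩
      p₁             <⟨ p<p+q (ℚ.<-trans 0<ε (fromℚ< ε<p₂)) ⟩
      p₁ ℚ.+ p₂      <⟨ <q ⟩
      q              ∎)
    where
    open ℚ.≤-Reasoning
    b*π≤b*r : ∀ a → log ℓ <ℚ a → π₋ H ℚ.* a ℚ.< p → b ℚ.* π₋ H ℚ.≤ b ℚ.* r
    b*π≤b*r a ℓ<a πa<p = begin
      b ℚ.* π₋ H     ≡⟨ ℚ.*-comm b (π₋ H) ⟩
      π₋ H ℚ.* b     ≤⟨ *-monoˡ-≤ (0≤turán (χⱼ 1 H)) (ℚ.<⇒≤ (fromℚ< (b≤ a ℓ<a))) ⟩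
      π₋ H ℚ.* a     ≤⟨ ℚ.<⇒≤ πa<p ⟩
      p              ≤⟨ p≤rb ⟩
      r ℚ.* b        ≡⟨ ℚ.*-comm r b ⟩
      b ℚ.* r        ∎

  -- Replacing 3 + i by i costs at most 3 and the second term at most c; together they are less than
  -- ε i. The 3 is the error 2 of `log-locate` plus 1 for strictness.
  mean-small : ∀ m {i c ε} → ℕ⇒ℚ 3 ℚ.+ c ℚ.< i ℚ.* ε → 0ℚ ℚ.≤ c →
    turán m ℚ.* (ℕ⇒ℚ 3 ℚ.+ i) ℚ.+ (1ℚ ℚ.- turán m) ℚ.* c ℚ.< (turán m ℚ.+ ε) ℚ.* i
  mean-small m {i} {c} {ε} lt 0≤c = begin-strict
    π ℚ.* (ℕ⇒ℚ 3 ℚ.+ i) ℚ.+ (1ℚ ℚ.- π) ℚ.* c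
      ≡⟨ solve 4 (λ π t i c → π :* (t :+ i) :+ (con 1ℚ :- π) :* c := π :* i :+ (π :* t :+ (con 1ℚ :- π) :* c)) refl π (ℕ⇒ℚ 3) i c ⟩
    π ℚ.* i ℚ.+ (π ℚ.* ℕ⇒ℚ 3 ℚ.+ (1ℚ ℚ.- π) ℚ.* c)
      ≤⟨ ℚ.+-monoʳ-≤ (π ℚ.* i) (ℚ.+-mono-≤ (*-monoʳ-≤ (0≤ℕ⇒ℚ 3) (turán≤1 m)) (*-monoʳ-≤ 0≤c 1-π≤1)) ⟩
    π ℚ.* i ℚ.+ (1ℚ ℚ.* ℕ⇒ℚ 3 ℚ.+ 1ℚ ℚ.* c)
      ≡⟨ cong (λ x → π ℚ.* i ℚ.+ x) (cong₂ ℚ._+_ (ℚ.*-identityˡ (ℕ⇒ℚ 3)) (ℚ.*-identityˡ c)) ⟩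
    π ℚ.* i ℚ.+ (ℕ⇒ℚ 3 ℚ.+ c)
      <⟨ ℚ.+-monoʳ-< (π ℚ.* i) lt ⟩
    π ℚ.* i ℚ.+ i ℚ.* ε
      ≡⟨ solve 3 (λ π i ε → π :* i :+ i :* ε := (π :+ ε) :* i) refl π i ε ⟩
    (π ℚ.+ ε) ℚ.* i ∎
    where
    open ℚ.≤-Reasoning
    π = turán m
    1-π≤1 : 1ℚ ℚ.- π ℚ.≤ 1ℚ
    1-π≤1 = ℚ.≤-trans (p≤q+p (0≤turán m)) (ℚ.≤-reflexive (solve 1 (λ x → x :+ (con 1ℚ :- x) := con 1ℚ) refl π))

  -- The i of `log-locate` is an admissible divisor, and log ℓ exceeds it by at most 2, a bounded
  -- error absorbed by ε i.
  ratio-upper : ∀ H → 1 ℕ.≤ e H → ∀ ε → 0ℚ ℚ.< ε → ∃[ L ] ∀ ℓ → L ℕ.≤ ℓ → e H ℕ.≤ ℓ →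
    λ[ H , ℓ ] ÷ log ℓ ≤ fromℚ (π₋ H) + fromℚ ε
  ratio-upper H 1≤e ε 0<ε = proj₁ unbounded , ratio≤
    where
    r = π₋ H ℚ.+ ε
    c = ℕ⇒ℚ (suc (e H ∸ 1))
    scale = archimedean-* (ℕ⇒ℚ 3 ℚ.+ c) 0<ε
    N = proj₁ scale
    -- The 3 forces i > N, through 3 + N ≤ log ℓ ≤ 2 + i.
    unbounded = log-unbounded (3 ℕ.+ N)
    λ<ri : ∀ ℓ → e H ℕ.≤ ℓ → ∀ i → N ℕ.< i → log ℓ ≤ fromℚ (ℕ⇒ℚ (2 ℕ.+ i)) → λ[ H , ℓ ] <ℚ r ℚ.* ℕ⇒ℚ i
    λ<ri ℓ e≤ℓ i N<i ≤2+i = upper-bound H ℓ 1≤e e≤ℓ (r ℚ.* ℕ⇒ℚ i)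
      (mix-intro (π₋ H) (1ℚ ℚ.- π₋ H) (log ℓ) (log (e H ∸ 1)) ℓ<3+i (log<suc (e H ∸ 1))
        (mean-small (χⱼ 1 H) (ℚ.<-≤-trans (proj₂ scale) (*-monoʳ-≤ (ℚ.<⇒≤ 0<ε) (ℕ⇒ℚ-mono-≤ N<i))) (0≤ℕ⇒ℚ (suc (e H ∸ 1)))))
      where
      ℓ<3+i : log ℓ <ℚ ℕ⇒ℚ 3 ℚ.+ ℕ⇒ℚ i
      ℓ<3+i = subst (log ℓ <ℚ_) (ℕ⇒ℚ-+ 3 i) (≤2+i _ (_ , refl , ℕ⇒ℚ-mono-< (ℕ.n<1+n (2 ℕ.+ i))))
    ratio≤ : ∀ ℓ → proj₁ unbounded ℕ.≤ ℓ → e H ℕ.≤ ℓ → λ[ H , ℓ ] ÷ log ℓ ≤ fromℚ (π₋ H) + fromℚ ε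
    ratio≤ ℓ L≤ℓ e≤ℓ q (_ , (p₁ , p₂ , π<p₁ , ε<p₂ , refl) , <q) =
      let i , i≤ , ≤2+i = log-locate ℓ
          3+N≤2+i = ≤-trans (fromℚ (ℕ⇒ℚ (3 ℕ.+ N))) (log ℓ) (fromℚ (ℕ⇒ℚ (2 ℕ.+ i))) (proj₂ unbounded ℓ L≤ℓ) ≤2+i
          N<i = ℕ.+-cancelˡ-≤ 2 (suc N) i (ℕ⇒ℚ-cancel-≤ {3 ℕ.+ N} {2 ℕ.+ i} (fromℚ-cancel-≤ 3+N≤2+i))
      in r , (r ℚ.* ℕ⇒ℚ i , ℕ⇒ℚ i , λ<ri ℓ e≤ℓ i N<i ≤2+i , 0<ℕ⇒ℚ i {{ℕ.>-nonZero (ℕ.≤-trans (s≤s z≤n) N<i)}} , i≤ , ℚ.≤-refl) ,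
         ℚ.<-trans (ℚ.+-mono-< (fromℚ< π<p₁) (fromℚ< ε<p₂)) <q

  ratio-tendsto : ∀ H → 2 ℕ.≤ e H → Tendsto (λ ℓ → λ[ H , ℓ ] ÷ log ℓ) (fromℚ (π₋ H))
  ratio-tendsto H 2≤e ε 0<ε =
    let L , upper = ratio-upper H (ℕ.<⇒≤ 2≤e) ε 0<ε in
    L ℕ.⊔ e H , λ ℓ large → let e≤ℓ = ℕ.m⊔n≤o⇒n≤o L (e H) large in
    ratio-lower H ℓ 2≤e e≤ℓ ε 0<ε , upper ℓ (ℕ.m⊔n≤o⇒m≤o L (e H) large) e≤ℓ

  turán≡0 : ∀ {m} → m ℕ.≤ 2 → turán m ≡ 0ℚ
  turán≡0 z≤n             = refl
  turán≡0 (s≤s z≤n)       = refl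
  turán≡0 (s≤s (s≤s z≤n)) = refl

  ≤2*turán : ∀ {m} → 3 ℕ.≤ m → 1ℚ ℚ.≤ ℕ⇒ℚ 2 ℚ.* turán m
  ≤2*turán {m} 3≤m = *-cancelˡ-≤ (0<ℕ⇒ℚ (suc R)) (begin
    ℕ⇒ℚ (suc R) ℚ.* 1ℚ                        ≡⟨ ℚ.*-identityʳ (ℕ⇒ℚ (suc R)) ⟩
    ℕ⇒ℚ (suc R)                               ≤⟨ ℕ⇒ℚ-mono-≤ 1+R≤2R ⟩
    ℕ⇒ℚ (2 ℕ.* R)                             ≡⟨ ℕ⇒ℚ-* 2 R ⟩
    ℕ⇒ℚ 2 ℚ.* ℕ⇒ℚ R                           ≡⟨ cong (ℕ⇒ℚ 2 ℚ.*_) (*-turán m) ⟨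
    ℕ⇒ℚ 2 ℚ.* (ℕ⇒ℚ (suc R) ℚ.* turán m)       ≡⟨ solve 3 (λ x y z → x :* (y :* z) := y :* (x :* z)) refl (ℕ⇒ℚ 2) (ℕ⇒ℚ (suc R)) (turán m) ⟩
    ℕ⇒ℚ (suc R) ℚ.* (ℕ⇒ℚ 2 ℚ.* turán m)       ∎)
    where
    open ℚ.≤-Reasoning
    R = m ∸ 2
    1+R≤2R : suc R ℕ.≤ 2 ℕ.* R
    1+R≤2R = ℕ.≤-trans (ℕ.+-monoˡ-≤ R (ℕ.∸-monoˡ-≤ 2 3≤m)) (ℕ.≤-reflexive (cong (R ℕ.+_) (sym (ℕ.+-identityʳ R))))

  -- The lower bound at j = e(H) - 1 is a mean of log ℓ and log j, hence at least the smaller one,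
  -- log j.
  log≤λ : ∀ H ℓ → 2 ℕ.≤ e H → e H ℕ.≤ ℓ → log (e H ∸ 1) ≤ λ[ H , ℓ ]
  log≤λ H ℓ 2≤e e≤ℓ q λ<q =
    let a , c , ℓ<a , e<c , mean<q = mix-elim π (1ℚ ℚ.- π) (log ℓ) (log j)
          (lower-bound H ℓ e≤ℓ j (ℕ.∸-monoˡ-≤ 1 2≤e) j<e q λ<q)
    in <ℚ-≤ (log j) (⊓-<ℚ (log j) (log-mono-≤ j ℓ (ℕ.≤-trans (ℕ.<⇒≤ j<e) e≤ℓ) a ℓ<a) e<c)
         (ℚ.≤-trans (min≤mean (χⱼ j H) a c) (ℚ.<⇒≤ mean<q))
    where
    j = e H ∸ 1
    π = πⱼ j H
    j<e : j ℕ.< e H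
    j<e = ℕ.∸-monoʳ-< {e H} (s≤s z≤n) (ℕ.<⇒≤ 2≤e)

  bipartite⇒λ≈log : ∀ H → 2 ℕ.≤ e H → ∀ i → Bipartite (H - ⁅ i ⁆) → ∀ ℓ → e H ℕ.≤ ℓ → λ[ H , ℓ ] ≈ log (e H ∸ 1)
  bipartite⇒λ≈log H 2≤e i bip ℓ e≤ℓ = upper , log≤λ H ℓ 2≤e e≤ℓ
    where
    upper : λ[ H , ℓ ] ≤ log (e H ∸ 1)
    upper q <q = let p , p<q , <p = ℝ.rounded (log (e H ∸ 1)) <q in
      -- Here π₋ is 0, so the crude rational `suc ℓ` above log ℓ gets weight 0.
      upper-bound H ℓ (ℕ.<⇒≤ 2≤e) e≤ℓ q (mix-intro (π₋ H) (1ℚ ℚ.- π₋ H) (log ℓ) (log (e H ∸ 1)) (log<suc ℓ) <p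
        (subst (ℚ._< q) (trans (solve 2 (λ a p → p := con 0ℚ :* a :+ (con 1ℚ :- con 0ℚ) :* p) refl (ℕ⇒ℚ (suc ℓ)) p)
          (cong (λ π → π ℚ.* ℕ⇒ℚ (suc ℓ) ℚ.+ (1ℚ ℚ.- π) ℚ.* p) (sym (turán≡0 (χ₁≤ H i bip))))) p<q))

  -- If χ₁ were at least 3, then π₋ ≥ 1/2, and π₋ log ℓ ≤ λ = log (e(H) - 1) would keep log ℓ below
  -- a constant for all ℓ.
  λ≈log⇒χ₁≤2 : ∀ H → 2 ℕ.≤ e H → (∀ ℓ → e H ℕ.≤ ℓ → λ[ H , ℓ ] ≈ log (e H ∸ 1)) → χⱼ 1 H ℕ.≤ 2
  λ≈log⇒χ₁≤2 H 2≤e λ≈log = ℕ.≮⇒≥ λ 3≤χ →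
    let a , ℓ<a , πa<s = turán·log≤ H ℓ 2≤e e≤ℓ (proj₁ (λ≈log ℓ e≤ℓ) s (log<suc (e H ∸ 1)))
    in ℚ.<-irrefl refl (begin-strict
      ℕ⇒ℚ (2 ℕ.* suc (e H ∸ 1))   <⟨ fromℚ< (proj₂ unbounded ℓ (ℕ.m≤m⊔n (proj₁ unbounded) (e H)) a ℓ<a) ⟩
      a                           ≡⟨ ℚ.*-identityˡ a ⟨
      1ℚ ℚ.* a                    ≤⟨ *-monoʳ-≤ (log-pos ℓ ℓ<a) (≤2*turán 3≤χ) ⟩
      ℕ⇒ℚ 2 ℚ.* π₋ H ℚ.* a        ≡⟨ ℚ.*-assoc (ℕ⇒ℚ 2) (π₋ H) a ⟩
      ℕ⇒ℚ 2 ℚ.* (π₋ H ℚ.* a)      ≤⟨ *-monoˡ-≤ (0≤ℕ⇒ℚ 2) (ℚ.<⇒≤ πa<s) ⟩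
      ℕ⇒ℚ 2 ℚ.* s                 ≡⟨ ℕ⇒ℚ-* 2 (suc (e H ∸ 1)) ⟨
      ℕ⇒ℚ (2 ℕ.* suc (e H ∸ 1))   ∎)
    where
    open ℚ.≤-Reasoning
    s = ℕ⇒ℚ (suc (e H ∸ 1))
    unbounded = log-unbounded (2 ℕ.* suc (e H ∸ 1))
    ℓ = proj₁ unbounded ℕ.⊔ e H
    e≤ℓ : e H ℕ.≤ ℓ
    e≤ℓ = ℕ.m≤n⊔m (proj₁ unbounded) (e H)

  χ₁≤2⇒bipartite : ∀ H → 1 ℕ.≤ e H → χⱼ 1 H ℕ.≤ 2 → ∃[ i ] Bipartite (H - ⁅ i ⁆)
  χ₁≤2⇒bipartite H 1≤e χ≤2 = let i , c = χ₁-attained H 1≤e in i , colorable-mono (H - ⁅ i ⁆) χ≤2 c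

open import Defs
open import Data.Nat.Base as ℕ using (ℕ; _∸_)
open import Data.Product.Base using (Σ-syntax; ∃-syntax; _×_; _,_)
open import Data.Rational.Base as ℚ using (1ℚ)
open import Data.Fin.Subset using (⁅_⁆)
open import Function.Bundles using (_⇔_)
import Data.Nat.Properties as ℕ
open import Function.Bundles using (mk⇔)
open Bounds using (sup-least; lower-bound; upper-bound)
open Limits

theorem1p5 : (H : Graph) → NoIsolated H → NonMatching H → 3 ℕ.≤ e H →
  (∀ (ℓ : ℕ) → e H ℕ.≤ ℓ →
    (sup (λ ((j , _) : Σ[ j ∈ ℕ ] 1 ℕ.≤ j × j ℕ.≤ e H ∸ 1) → πⱼ j H · log ℓ + (1ℚ ℚ.- πⱼ j H) · log j) ≤ λ[ H , ℓ ])
    × (λ[ H , ℓ ] ≤ π₋ H · log ℓ + (1ℚ ℚ.- π₋ H) · log (e H ∸ 1)))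
  × Tendsto (λ ℓ → λ[ H , ℓ ] ÷ log ℓ) (fromℚ (π₋ H))
  × ((∀ (ℓ : ℕ) → e H ℕ.≤ ℓ → λ[ H , ℓ ] ≈ log (e H ∸ 1)) ⇔ (∃[ i ] Bipartite (H - ⁅ i ⁆)))
theorem1p5 H _ _ 3≤e =
  (λ ℓ e≤ℓ →
    sup-least (λ ((j , _) : Σ[ j ∈ ℕ ] 1 ℕ.≤ j × j ℕ.≤ e H ∸ 1) → πⱼ j H · log ℓ + (1ℚ ℚ.- πⱼ j H) · log j)
      λ[ H , ℓ ] (λ (j , 1≤j , j≤e-1) → lower-bound H ℓ e≤ℓ j 1≤j (ℕ.≤-<-trans j≤e-1 e-1<e)) ,
    upper-bound H ℓ (ℕ.<⇒≤ 2≤e) e≤ℓ) ,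
  ratio-tendsto H 2≤e ,
  mk⇔ (λ λ≈log → χ₁≤2⇒bipartite H (ℕ.<⇒≤ 2≤e) (λ≈log⇒χ₁≤2 H 2≤e λ≈log))
      (λ (i , bipartite) → bipartite⇒λ≈log H 2≤e i bipartite)
  where
  2≤e : 2 ℕ.≤ e H
  2≤e = ℕ.<⇒≤ 3≤e
  e-1<e : e H ∸ 1 ℕ.< e H
  e-1<e = ℕ.∸-monoʳ-< {e H} (ℕ.s≤s ℕ.z≤n) (ℕ.<⇒≤ 2≤e)
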